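{- The following decision problems are undecidable, both for $\mathcal{F}=\mathrm{sHML}^d$ and for $\mathcal{F}=\mu\mathrm{HML}^d$: (1) given a closed formula $\varphi\in\mathcal{F}$, is $\varphi$ monitorable for satisfactions? (2) given a closed formula $\varphi\in\mathcal{F}$, is $\varphi$ effectively monitorable for satisfactions?
   Context: **Data and traces.** Fix a countably infinite set $\mathbb{D}$ (data values; encoded so that Turing machines can process finite sequences over it) whose only predicate is equality, which is decidable. $\mathrm{Trc}=\mathbb{D}^\omega$; finite traces are elements of $\mathbb{D}^*$. **Logic $\mu\mathrm{HML}^d$.** Let $\mathrm{DVar}$ and $\mathrm{FVar}$ be countably infinite sets of data variables $x$ and recursion variables $X$; $\star\notin\mathrm{DVar}$ is a placeholder for the current data value. Constraint expressions: $b::=\mathsf{true}\mid e=f\mid\neg b\mid b\wedge b$, with $e,f\in\mathrm{DVar}\cup\{\star\}$. Formulae: $\varphi::=\mathsf{tt}\mid\mathsf{ff}\mid\langle b\rangle\varphi\mid[b]\varphi\mid\exists x.\varphi\mid\forall x.\varphi\mid\varphi\vee\varphi\mid\varphi\wedge\varphi\mid\min X.\varphi\mid\max X.\varphi\mid X$. A data environment $\delta$ is a finite partial function $\mathrm{DVar}\rightharpoonup\mathbb{D}$; data interpretations $F$ map data environments to subsets of $\mathrm{Trc}$ (ordered pointwise by inclusion); trace environments $\rho$ map recursion variables to data interpretations. Semantics: $\mathsf{tt}\mapsto\mathrm{Trc}$; $\mathsf{ff}\mapsto\varnothing$; $[\![X,\rho,\delta]\!]=\rho(X)(\delta)$; $[\![\langle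 b\rangle\varphi,\rho,\delta]\!]=\{du\mid b\text{ true under }\delta[\star\mapsto d]\text{ and }u\in[\![\varphi,\rho,\delta]\!]\}$; $[\![[b]\varphi,\rho,\delta]\!]=\{du\mid b\text{ true under }\delta[\star\mapsto d]\text{ implies }u\in[\![\varphi,\rho,\delta]\!]\}$; $[\![\exists x.\varphi,\rho,\delta]\!]=\bigcup_{d}[\![\varphi,\rho,\delta[x\mapsto d]]\!]$; $[\![\forall x.\varphi,\rho,\delta]\!]=\bigcap_{d}[\![\varphi,\rho,\delta[x\mapsto d]]\!]$; $\vee,\wedge$ are union, intersection; $[\![\min X.\varphi,\rho,\delta]\!]$ (resp. $\max$) is the value at $\delta$ of the least (resp. greatest) fixed point of $F\mapsto\lambda\delta'.[\![\varphi,\rho[X\mapsto F],\delta']\!]$. For closed $\varphi$ write $[\![\varphi]\!]$. Standing assumption: each occurrence of a recursion variable is in the scope of a modality inside its defining fixed-point formula. The fragment $\mathrm{sHML}^d$: $\varphi::=\mathsf{ff}\mid[b]\varphi\mid\forall x.\varphi\mid\varphi\vee\varphi\mid\varphi\wedge\varphi\mid\max X.\varphi\mid X$. **Monitorability.** A monitor is an object $m$ with predicates $\mathbf{acc}(m,w)$, $\mathbf{rej}(m,w)$ on $w\in\mathbb{D}^*$ such that no $w$ satisfies both and both are preserved when extending $w$; for $t\in\mathrm{Trc}$, $\mathbf{acc}(m,t)$ iff $\mathbf{acc}(m,w)$ for some finite prefix $w$ of $t$. $\varphi$ is monitorable for satisfactions if there is a monitor $m$ (no computability requirement) with $\mathbf{acc}(m,t)\Leftrightarrow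 t\in[\![\varphi]\!]$ for all $t\in\mathrm{Trc}$. $\varphi$ is effectively monitorable for satisfactions if there is a Turing machine such that for every $t\in\mathrm{Trc}$, $t\in[\![\varphi]\!]$ if and only if some finite prefix of $t$ is accepted by the Turing machine. -}

module Defs where

open import Axiom.ExcludedMiddle using (ExcludedMiddle)
open import Data.Bool.Base using (Bool; true; false)
open import Data.Empty using (⊥)
open import Data.Fin.Base using (Fin)
open import Data.List.Base
  using (List; []; _∷_; _++_; map; replicate; concatMap; applyUpTo)
open import Data.List.Membership.Propositional using (_∈_; _∉_)
open import Data.Maybe.Base using (Maybe; just; nothing)
open import Data.Nat.Base using (ℕ; zero; suc)
open import Data.Nat.GeneralisedArithmetic using (iterate)
open import Data.Nat.Properties using (_≟_)
open import Data.Product.Base using (_×_; _,_; ∃-syntax)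
open import Data.Sum.Base using (_⊎_; inj₁; inj₂)
open import Data.Unit.Base using (⊤)
open import Function.Base using (_∘_)
open import Function.Bundles using (_↔_; _⇔_; Inverse)
open import Level using (0ℓ; _⊔_) renaming (suc to lsuc)
open import Relation.Binary.PropositionalEquality using (_≡_)
open import Relation.Nullary using (¬_; yes; no)
open import Relation.Nullary.Decidable using (True; toWitness; fromWitness)

------------------------------------------------------------------------
-- Deterministic one-tape Turing machines over an input alphabet Σ.  Only
-- finite enumeration types are used for Σ below, so that the transition
-- function is a finite table.

data Symbol (Σ : Set) (k : ℕ) : Set where
  blank : Symbol Σ k
  input : Σ → Symbol Σ k
  work  : Fin k → Symbol Σ k

data Move : Set where
  left right : Move

data State (q : ℕ) : Set where
  accept reject : State q
  run           : Fin q → State q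

record TM (Σ : Set) : Set where
  field
    q k   : ℕ
    start : State q
    δ     : Fin q → Symbol Σ k → State q × Symbol Σ k × Move

module _ {Σ : Set} (M : TM Σ) where
  open TM M

  -- The tape is two-way infinite.  ls lists the cells to the left of the
  -- head, nearest first; cells not listed are blank.
  record Config : Set where
    constructor config
    field
      state : State q
      ls    : List (Symbol Σ k)
      head  : Symbol Σ k
      rs    : List (Symbol Σ k)

  write-move : State q → Symbol Σ k × Move →
               List (Symbol Σ k) → List (Symbol Σ k) → Config
  write-move s (a , left)  []       rs       = config s [] blank (a ∷ rs)
  write-move s (a , left)  (l ∷ ls) rs       = config s ls l (a ∷ rs)
  write-move s (a , right) ls       []       = config s (a ∷ ls) blank []
  write-move s (a , right) ls       (r ∷ rs) = config s (a ∷ ls) r rs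

  step : Config → Config
  step (config (run p) ls a rs) with δ p a
  ... | s , b , m = write-move s (b , m) ls rs
  step c = c

  initial : List Σ → Config
  initial []      = config start [] blank []
  initial (a ∷ w) = config start [] (input a) (map input w)

  Reaches : State q → List Σ → Set
  Reaches s w = ∃[ n ] Config.state (iterate step (initial w) n) ≡ s

  Accepts Rejects : List Σ → Set
  Accepts = Reaches accept
  Rejects = Reaches reject

-- M decides the problem "given x satisfying I, does P x hold?", where
-- instances are presented to M through code.
record _Decides_On_Via_ {a p i} {A : Set a} {Σ : Set} (M : TM Σ)
         (P : A → Set p) (I : A → Set i) (code : A → List Σ)
         : Set (a ⊔ p ⊔ i) where
  field
    halts   : ∀ x → I x → Accepts M (code x) ⊎ Rejects M (code x)
    correct : ∀ x → I x → Accepts M (code x) ⇔ P x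

------------------------------------------------------------------------
-- Syntax

DVar FVar : Set
DVar = ℕ
FVar = ℕ

data Term : Set where
  ⋆    : Term
  dvar : DVar → Term

infix  8 _≐_
infixr 7 _∧ᵇ_
infix  9 ¬ᵇ_

data Constraint : Set where
  trueᵇ : Constraint
  _≐_   : Term → Term → Constraint
  ¬ᵇ_   : Constraint → Constraint
  _∧ᵇ_  : Constraint → Constraint → Constraint

infixr 6 ⟨_⟩_ [_]_
infixr 5 _∧_
infixr 4 _∨_

data Formula : Set where
  ttᶠ ffᶠ     : Formula
  ⟨_⟩_ [_]_   : Constraint → Formula → Formula
  ∃ᶠ ∀ᶠ       : DVar → Formula → Formula
  _∨_ _∧_     : Formula → Formula → Formula
  minᶠ maxᶠ   : FVar → Formula → Formula
  fvar        : FVar → Formula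

μHML : Formula → Set
μHML _ = ⊤

data sHML : Formula → Set where
  ffˢ   : sHML ffᶠ
  boxˢ  : ∀ {b φ} → sHML φ → sHML ([ b ] φ)
  ∀ˢ    : ∀ {x φ} → sHML φ → sHML (∀ᶠ x φ)
  _∨ˢ_  : ∀ {φ ψ} → sHML φ → sHML ψ → sHML (φ ∨ ψ)
  _∧ˢ_  : ∀ {φ ψ} → sHML φ → sHML ψ → sHML (φ ∧ ψ)
  maxˢ  : ∀ {X φ} → sHML φ → sHML (maxᶠ X φ)
  fvarˢ : ∀ {X} → sHML (fvar X)

TermIn : List DVar → Term → Set
TermIn xs ⋆        = ⊤
TermIn xs (dvar x) = x ∈ xs

ConstraintIn : List DVar → Constraint → Set
ConstraintIn xs trueᵇ    = ⊤
ConstraintIn xs (e ≐ f)  = TermIn xs e × TermIn xs f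
ConstraintIn xs (¬ᵇ b)   = ConstraintIn xs b
ConstraintIn xs (b ∧ᵇ c) = ConstraintIn xs b × ConstraintIn xs c

-- The free data variables are among xs and the free recursion variables
-- among Xs.
FormulaIn : List DVar → List FVar → Formula → Set
FormulaIn xs Xs ttᶠ        = ⊤
FormulaIn xs Xs ffᶠ        = ⊤
FormulaIn xs Xs (⟨ b ⟩ φ)  = ConstraintIn xs b × FormulaIn xs Xs φ
FormulaIn xs Xs ([ b ] φ)  = ConstraintIn xs b × FormulaIn xs Xs φ
FormulaIn xs Xs (∃ᶠ x φ)   = FormulaIn (x ∷ xs) Xs φ
FormulaIn xs Xs (∀ᶠ x φ)   = FormulaIn (x ∷ xs) Xs φ
FormulaIn xs Xs (φ ∨ ψ)    = FormulaIn xs Xs φ × FormulaIn xs Xs ψ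
FormulaIn xs Xs (φ ∧ ψ)    = FormulaIn xs Xs φ × FormulaIn xs Xs ψ
FormulaIn xs Xs (minᶠ X φ) = FormulaIn xs (X ∷ Xs) φ
FormulaIn xs Xs (maxᶠ X φ) = FormulaIn xs (X ∷ Xs) φ
FormulaIn xs Xs (fvar X)   = X ∈ Xs

Closed : Formula → Set
Closed = FormulaIn [] []

-- Xs collects the recursion variables bound since the last modality; none
-- of them may occur before the next modality.
GuardedIn : List FVar → Formula → Set
GuardedIn Xs ttᶠ        = ⊤
GuardedIn Xs ffᶠ        = ⊤
GuardedIn Xs (⟨ b ⟩ φ)  = GuardedIn [] φ
GuardedIn Xs ([ b ] φ)  = GuardedIn [] φ
GuardedIn Xs (∃ᶠ x φ)   = GuardedIn Xs φ
GuardedIn Xs (∀ᶠ x φ)   = GuardedIn Xs φ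
GuardedIn Xs (φ ∨ ψ)    = GuardedIn Xs φ × GuardedIn Xs ψ
GuardedIn Xs (φ ∧ ψ)    = GuardedIn Xs φ × GuardedIn Xs ψ
GuardedIn Xs (minᶠ X φ) = GuardedIn (X ∷ Xs) φ
GuardedIn Xs (maxᶠ X φ) = GuardedIn (X ∷ Xs) φ
GuardedIn Xs (fvar X)   = X ∉ Xs

Guarded : Formula → Set
Guarded = GuardedIn []

------------------------------------------------------------------------
-- Formulae as Turing machine inputs: Polish notation, with variables
-- written in unary.

data Token : Set where
  true′ eq′ not′ and′ star′ dvar′           : Token
  tt′ ff′ dia′ box′ ex′ all′ or′ con′       : Token
  min′ max′ fvar′                           : Token
  stroke end                                : Token

codeVar : ℕ → List Token
codeVar n = replicate n stroke ++ end ∷ []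

codeTerm : Term → List Token
codeTerm ⋆        = star′ ∷ []
codeTerm (dvar x) = dvar′ ∷ codeVar x

codeConstraint : Constraint → List Token
codeConstraint trueᵇ    = true′ ∷ []
codeConstraint (e ≐ f)  = eq′ ∷ codeTerm e ++ codeTerm f
codeConstraint (¬ᵇ b)   = not′ ∷ codeConstraint b
codeConstraint (b ∧ᵇ c) = and′ ∷ codeConstraint b ++ codeConstraint c

codeFormula : Formula → List Token
codeFormula ttᶠ        = tt′ ∷ []
codeFormula ffᶠ        = ff′ ∷ []
codeFormula (⟨ b ⟩ φ)  = dia′ ∷ codeConstraint b ++ codeFormula φ
codeFormula ([ b ] φ)  = box′ ∷ codeConstraint b ++ codeFormula φ
codeFormula (∃ᶠ x φ)   = ex′ ∷ codeVar x ++ codeFormula φ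
codeFormula (∀ᶠ x φ)   = all′ ∷ codeVar x ++ codeFormula φ
codeFormula (φ ∨ ψ)    = or′ ∷ codeFormula φ ++ codeFormula ψ
codeFormula (φ ∧ ψ)    = con′ ∷ codeFormula φ ++ codeFormula ψ
codeFormula (minᶠ X φ) = min′ ∷ codeVar X ++ codeFormula φ
codeFormula (maxᶠ X φ) = max′ ∷ codeVar X ++ codeFormula φ
codeFormula (fvar X)   = fvar′ ∷ codeVar X

-- Undecidability of "given a closed (guarded) formula φ in F, does P φ
-- hold?"  The machine may behave arbitrarily on all other inputs.
Undecidable : ∀ {ℓ} → (Formula → Set) → (Formula → Set ℓ) → Set ℓ
Undecidable F P =
  ¬ (∃[ M ] M Decides P On (λ φ → F φ × Closed φ × Guarded φ) Via codeFormula)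

------------------------------------------------------------------------
-- Semantics and monitorability.  The data values 𝔻 are any countably
-- infinite set; the bijection with ℕ serves only to write them on a tape.
--
-- The metatheory is classical.  Excluded middle gives ∃ᶠ and ∨ their usual
-- reading, and it makes the powerset of traces small, so that the lattice
-- of data interpretations is complete.

module Logic (em : ExcludedMiddle (lsuc 0ℓ)) (𝔻 : Set) (𝔻↔ℕ : 𝔻 ↔ ℕ) where

  Trc : Set
  Trc = ℕ → 𝔻

  prefix : Trc → ℕ → List 𝔻
  prefix = applyUpTo

  -- A finite partial function, as an association list in which the first
  -- entry for a variable counts; [] is the nowhere defined environment.
  DEnv : Set
  DEnv = List (DVar × 𝔻)

  lookup : DEnv → DVar → Maybe 𝔻
  lookup []            x = nothing
  lookup ((y , d) ∷ δ) x with x ≟ y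
  ... | yes _ = just d
  ... | no  _ = lookup δ x

  Interp : Set₁
  Interp = DEnv → Trc → Set

  infix 4 _⊆_
  _⊆_ : Interp → Interp → Set
  F ⊆ G = ∀ δ t → F δ t → G δ t

  TEnv : Set₁
  TEnv = FVar → Interp

  _[_↦_] : TEnv → FVar → Interp → TEnv
  (ρ [ X ↦ F ]) Y with Y ≟ X
  ... | yes _ = F
  ... | no  _ = ρ Y

  value : DEnv → 𝔻 → Term → Maybe 𝔻
  value δ d ⋆        = just d
  value δ d (dvar x) = lookup δ x

  -- Truth under δ[⋆ ↦ d].  An equation mentioning an undefined variable is
  -- false; this case does not arise for closed formulae.
  Holds : DEnv → 𝔻 → Constraint → Set
  Holds δ d trueᵇ    = ⊤
  Holds δ d (e ≐ f)  = ∃[ v ] (value δ d e ≡ just v × value δ d f ≡ just v)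
  Holds δ d (¬ᵇ b)   = ¬ Holds δ d b
  Holds δ d (b ∧ᵇ c) = Holds δ d b × Holds δ d c

  -- A proposition in Set equivalent to P.
  small : Set₁ → Set
  small P = True (em {P})

  -- The meet of all pre-fixed points and the join of all post-fixed
  -- points; ⟦min⟧ and ⟦max⟧ below show that these are the least and the
  -- greatest fixed points in the semantics of minᶠ and maxᶠ.
  lfp gfp : (Interp → Interp) → Interp
  lfp Φ δ t = small (∀ (F : Interp) → Φ F ⊆ F → F δ t)
  gfp Φ δ t = small (∃[ F ] (F ⊆ Φ F × F δ t))

  ⟦_⟧ : Formula → TEnv → Interp
  ⟦ ttᶠ ⟧      ρ δ t = ⊤
  ⟦ ffᶠ ⟧      ρ δ t = ⊥
  ⟦ ⟨ b ⟩ φ ⟧  ρ δ t = Holds δ (t 0) b × ⟦ φ ⟧ ρ δ (t ∘ suc)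
  ⟦ [ b ] φ ⟧  ρ δ t = Holds δ (t 0) b → ⟦ φ ⟧ ρ δ (t ∘ suc)
  ⟦ ∃ᶠ x φ ⟧   ρ δ t = ∃[ d ] ⟦ φ ⟧ ρ ((x , d) ∷ δ) t
  ⟦ ∀ᶠ x φ ⟧   ρ δ t = ∀ d → ⟦ φ ⟧ ρ ((x , d) ∷ δ) t
  ⟦ φ ∨ ψ ⟧    ρ δ t = ⟦ φ ⟧ ρ δ t ⊎ ⟦ ψ ⟧ ρ δ t
  ⟦ φ ∧ ψ ⟧    ρ δ t = ⟦ φ ⟧ ρ δ t × ⟦ ψ ⟧ ρ δ t
  ⟦ minᶠ X φ ⟧ ρ     = lfp (λ F → ⟦ φ ⟧ (ρ [ X ↦ F ]))
  ⟦ maxᶠ X φ ⟧ ρ     = gfp (λ F → ⟦ φ ⟧ (ρ [ X ↦ F ]))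
  ⟦ fvar X ⟧   ρ     = ρ X

  -- For closed formulae the choice of environments is immaterial.
  infix 4 _⊨_
  _⊨_ : Trc → Formula → Set
  t ⊨ φ = ⟦ φ ⟧ (λ _ _ _ → ⊥) [] t

  record Monitor : Set₁ where
    field
      acc rej  : List 𝔻 → Set
      disjoint : ∀ w → ¬ (acc w × rej w)
      acc-ext  : ∀ w v → acc w → acc (w ++ v)
      rej-ext  : ∀ w v → rej w → rej (w ++ v)

  MonitorableSat : Formula → Set₁
  MonitorableSat φ =
    ∃[ m ] (∀ t → (∃[ n ] Monitor.acc m (prefix t n)) ⇔ (t ⊨ φ))

  -- d is written as true repeated toℕ d times, followed by false.
  codeWord : List 𝔻 → List Bool
  codeWord =
    concatMap (λ d → replicate (Inverse.to 𝔻↔ℕ d) true ++ false ∷ [])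

  EffectivelyMonitorableSat : Formula → Set
  EffectivelyMonitorableSat φ =
    ∃[ M ] (∀ t → (t ⊨ φ) ⇔ (∃[ n ] Accepts M (codeWord (prefix t n))))

  ----------------------------------------------------------------------
  -- Adequacy of lfp and gfp

  _⊑_ : TEnv → TEnv → Set
  ρ ⊑ ρ′ = ∀ X → ρ X ⊆ ρ′ X

  update-mono : ∀ {ρ ρ′ F G} X → ρ ⊑ ρ′ → F ⊆ G →
                (ρ [ X ↦ F ]) ⊑ (ρ′ [ X ↦ G ])
  update-mono X ρ⊑ F⊆ Y with Y ≟ X
  ... | yes _ = F⊆
  ... | no  _ = ρ⊑ Y

  ⟦_⟧-mono : ∀ φ {ρ ρ′} → ρ ⊑ ρ′ → ⟦ φ ⟧ ρ ⊆ ⟦ φ ⟧ ρ′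
  ⟦ ttᶠ ⟧-mono      le δ t p        = p
  ⟦ ffᶠ ⟧-mono      le δ t p        = p
  ⟦ ⟨ b ⟩ φ ⟧-mono  le δ t (h , p)  = h , ⟦ φ ⟧-mono le δ _ p
  ⟦ [ b ] φ ⟧-mono  le δ t p        = λ h → ⟦ φ ⟧-mono le δ _ (p h)
  ⟦ ∃ᶠ x φ ⟧-mono   le δ t (d , p)  = d , ⟦ φ ⟧-mono le _ t p
  ⟦ ∀ᶠ x φ ⟧-mono   le δ t p        = λ d → ⟦ φ ⟧-mono le _ t (p d)
  ⟦ φ ∨ ψ ⟧-mono    le δ t (inj₁ p) = inj₁ (⟦ φ ⟧-mono le δ t p)
  ⟦ φ ∨ ψ ⟧-mono    le δ t (inj₂ p) = inj₂ (⟦ ψ ⟧-mono le δ t p)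
  ⟦ φ ∧ ψ ⟧-mono    le δ t (p , q)  =
    ⟦ φ ⟧-mono le δ t p , ⟦ ψ ⟧-mono le δ t q
  ⟦ minᶠ X φ ⟧-mono le δ t p = fromWitness λ F pre → toWitness p F
    λ δ′ t′ q →
      pre δ′ t′ (⟦ φ ⟧-mono (update-mono X le (λ _ _ r → r)) δ′ t′ q)
  ⟦ maxᶠ X φ ⟧-mono le δ t p with toWitness p
  ... | F , post , q = fromWitness (F ,
    (λ δ′ t′ r →
      ⟦ φ ⟧-mono (update-mono X le (λ _ _ s → s)) δ′ t′ (post δ′ t′ r)) , q)
  ⟦ fvar X ⟧-mono   le δ t p        = le X δ t p

  IsFixedPoint : (Interp → Interp) → Interp → Set
  IsFixedPoint Φ F = Φ F ⊆ F × F ⊆ Φ F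

  IsLeastFixedPoint IsGreatestFixedPoint : (Interp → Interp) → Interp → Set₁
  IsLeastFixedPoint Φ F    = IsFixedPoint Φ F × (∀ G → IsFixedPoint Φ G → F ⊆ G)
  IsGreatestFixedPoint Φ F = IsFixedPoint Φ F × (∀ G → IsFixedPoint Φ G → G ⊆ F)

  ⟦min⟧ : ∀ X φ ρ →
    IsLeastFixedPoint (λ F → ⟦ φ ⟧ (ρ [ X ↦ F ])) (⟦ minᶠ X φ ⟧ ρ)
  ⟦min⟧ X φ ρ = (pre , post) , λ { G (h , _) → least G h }
    where
    Φ : Interp → Interp
    Φ F = ⟦ φ ⟧ (ρ [ X ↦ F ])
    mono : ∀ {F G} → F ⊆ G → Φ F ⊆ Φ G
    mono le = ⟦ φ ⟧-mono (update-mono X (λ _ _ _ r → r) le)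
    least : ∀ G → Φ G ⊆ G → lfp Φ ⊆ G
    least G h δ t p = toWitness p G h
    pre : Φ (lfp Φ) ⊆ lfp Φ
    pre δ t p = fromWitness λ G h → h δ t (mono (least G h) δ t p)
    post : lfp Φ ⊆ Φ (lfp Φ)
    post = least (Φ (lfp Φ)) (mono pre)

  ⟦max⟧ : ∀ X φ ρ →
    IsGreatestFixedPoint (λ F → ⟦ φ ⟧ (ρ [ X ↦ F ])) (⟦ maxᶠ X φ ⟧ ρ)
  ⟦max⟧ X φ ρ =
    (pre , post) , λ { G (_ , h) → greatest G h }
    where
    Φ : Interp → Interp
    Φ F = ⟦ φ ⟧ (ρ [ X ↦ F ])
    mono : ∀ {F G} → F ⊆ G → Φ F ⊆ Φ G
    mono le = ⟦ φ ⟧-mono (update-mono X (λ _ _ _ r → r) le)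
    greatest : ∀ G → G ⊆ Φ G → G ⊆ gfp Φ
    greatest G h δ t p = fromWitness (G , h , p)
    post : gfp Φ ⊆ Φ (gfp Φ)
    post δ t p with toWitness p
    ... | G , h , q = mono (greatest G h) δ t (h δ t q)
    pre : Φ (gfp Φ) ⊆ gfp Φ
    pre = greatest (Φ (gfp Φ)) (mono post)

open Logic public using (MonitorableSat; EffectivelyMonitorableSat)

{-# OPTIONS --safe #-}
module Submission where

-- For every Turing machine M we build a closed formula φ of sHML which says
-- that the trace is an infinite computation of M on the code of φ itself and
-- that this computation never rejects.  If M rejects the code of φ, no trace
-- satisfies φ, so φ is monitorable by a monitor that never accepts.  If M
-- accepts it, the computation can be continued for ever and some trace
-- satisfies φ; but replacing any tail of it by a constant one violates φ, so no
-- finite prefix can be accepted and φ is not monitorable.  Hence M decides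
-- neither problem.
--
-- A trace lists data values that serve as constants, then a mark, then blocks
-- of nine positions, one block per configuration.  The tape to the left and
-- to the right of the head is kept on two stacks of immutable linked cells
-- named by data values: for stack s a block contains the name ptr s of the top
-- cell and its contents top s and rest s.  It is enough to require that equal
-- names always have equal contents and that consecutive blocks obey the
-- transition table.  Neither distinct constants nor fresh names are required:
-- a coincidence can only make φ harder to satisfy.
--
-- The self-reference is a quine.  In φ = B (await (literal u) ∧ ψ), the chain
-- literal u forces the trace to spell out u = reverse tape, one token per
-- block, where tape is the code of the part of φ after the chain.  While it is
-- being spelled out, u is pushed onto both stacks.  Each token of u
-- contributes a fixed block of tokens to the code of φ, so the machine pops
-- the left copy, pushes the corresponding blocks onto the right stack, adds
-- the preamble, which depends on neither u nor M, and starts M.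

open import Defs
open import Axiom.ExcludedMiddle using (ExcludedMiddle)
open import Data.Bool.Base using (Bool)
open import Data.Empty using (⊥)
open import Data.Fin using (Fin; toℕ; #_)
open import Data.Fin.Properties using (toℕ-injective)
open import Data.List.Base
  using (List; []; _∷_; _++_; map; foldr; concatMap; cartesianProductWith;
         allFin; length; reverse; tails; _ʳ++_; drop; upTo; applyUpTo)
import Data.List.Base as List
open import Data.List.Membership.Propositional using (_∈_; _∉_; lose)
open import Data.List.Membership.Propositional.Properties
  using (∈-lookup; ∈-map⁺; ∈-map⁻; ∈-++⁺ˡ; ∈-++⁺ʳ; ∈-++⁻; ∈-allFin;
         ∈-concatMap⁺; ∈-cartesianProductWith⁺)
open import Data.List.Properties
  using (++-assoc; ++-identityʳ; concatMap-++; map-++; map-injective; map-ʳ++;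
         reverse-involutive; unfold-reverse; ʳ++-defn; ∷-injectiveˡ;
         ∷-injectiveʳ)
open import Data.List.Relation.Binary.Subset.Propositional using (_⊆_)
open import Data.List.Relation.Unary.All as All using (All; []; _∷_)
import Data.List.Relation.Unary.All.Properties as All
open import Data.List.Relation.Unary.Any using (here; there)
open import Data.Maybe.Base using (just; fromMaybe)
open import Data.Maybe.Properties using (just-injective)
open import Data.Nat.Base
  using (ℕ; zero; suc; _+_; _≤_; z≤n; s≤s; compare; less; equal; greater)
open import Data.Nat.Binary as ℕᵇ using (ℕᵇ; zero; 2[1+_]; 1+[2_])
import Data.Nat.Binary.Properties as ℕᵇ
open import Data.Nat.GeneralisedArithmetic using (iterate)
open import Data.Nat.Properties
  using (_≟_; +-cancelˡ-≡; +-identityʳ; +-suc; m≤n⇒m≤1+n)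
open import Data.Product using (∃-syntax; Σ-syntax; _×_; _,_; proj₁; proj₂)
open import Data.Sum using (_⊎_; inj₁; inj₂; [_,_]′)
open import Data.Unit.Base using (⊤; tt)
open import Function
  using (_∘_; _⇔_; mk⇔; Equivalence; _↔_; Inverse; Injective)
import Function.Properties.Equivalence as ⇔
open import Level using (0ℓ; Lift; lift; lower)
open import Relation.Binary.PropositionalEquality
  using (_≡_; _≢_; refl; sym; trans; cong; subst; subst₂; setoid;
         module ≡-Reasoning)
open import Relation.Nullary using (¬_; yes; no; contradiction)
open import Relation.Nullary.Decidable using (fromWitness)

-- Injective numbering of lists

unary : ℕ → ℕᵇ → ℕᵇ
unary zero    b = 1+[2 b ]
unary (suc n) b = 2[1+ unary n b ]

listCodeᵇ : List ℕ → ℕᵇ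
listCodeᵇ []       = zero
listCodeᵇ (n ∷ ns) = unary n (listCodeᵇ ns)

-- In bijective binary, least digit first, `unary` writes `n` as `n` twos closed by a one, so the
-- first one marks where `n` ends.
unary-injective : ∀ m n {b c} → unary m b ≡ unary n c → m ≡ n × b ≡ c
unary-injective zero    zero    refl = refl , refl
unary-injective (suc m) (suc n) eq
  with unary-injective m n (ℕᵇ.2[1+_]-injective eq)
... | refl , refl = refl , refl

listCodeᵇ-injective : Injective _≡_ _≡_ listCodeᵇ
listCodeᵇ-injective {[]}    {[]}        _  = refl
listCodeᵇ-injective {[]}    {zero ∷ _}  ()
listCodeᵇ-injective {[]}    {suc _ ∷ _} ()
listCodeᵇ-injective {zero ∷ _}  {[]}    ()
listCodeᵇ-injective {suc _ ∷ _} {[]}    ()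
listCodeᵇ-injective {m ∷ ms} {n ∷ ns} eq with unary-injective m n eq
... | refl , eqs = cong (m ∷_) (listCodeᵇ-injective eqs)

-- Abstract, so that typechecking never computes with these large numbers.
abstract
  listCode : List ℕ → ℕ
  listCode = ℕᵇ.toℕ ∘ listCodeᵇ

  listCode-injective : Injective _≡_ _≡_ listCode
  listCode-injective = listCodeᵇ-injective ∘ ℕᵇ.toℕ-injective

-- Numbering of tokens

tokens : List Token
tokens =
  true′ ∷ eq′ ∷ not′ ∷ and′ ∷ star′ ∷ dvar′ ∷ tt′ ∷ ff′ ∷ dia′ ∷ box′ ∷ ex′ ∷
  all′ ∷ or′ ∷ con′ ∷ min′ ∷ max′ ∷ fvar′ ∷ stroke ∷ end ∷ []

-- An index paired with the proof that it points to the token yields both completeness of `tokens`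
-- and injectivity of `tokenIndex`, from one case per token instead of one per pair.
locate : ∀ a → ∃[ i ] List.lookup tokens i ≡ a
locate true′  = # 0 , refl
locate eq′    = # 1 , refl
locate not′   = # 2 , refl
locate and′   = # 3 , refl
locate star′  = # 4 , refl
locate dvar′  = # 5 , refl
locate tt′    = # 6 , refl
locate ff′    = # 7 , refl
locate dia′   = # 8 , refl
locate box′   = # 9 , refl
locate ex′    = # 10 , refl
locate all′   = # 11 , refl
locate or′    = # 12 , refl
locate con′   = # 13 , refl
locate min′   = # 14 , refl
locate max′   = # 15 , refl
locate fvar′  = # 16 , refl
locate stroke = # 17 , refl
locate end    = # 18 , refl

∈-tokens : ∀ a → a ∈ tokens
∈-tokens a with locate a
... | i , refl = ∈-lookup i

tokenIndex : Token → ℕ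
tokenIndex = toℕ ∘ proj₁ ∘ locate

tokenIndex-injective : Injective _≡_ _≡_ tokenIndex
tokenIndex-injective {a} {b} eq with locate a | locate b | toℕ-injective eq
... | i , refl | _ , refl | refl = refl

-- Formulae that read a trace position by position

-- The quantifier acts as a let: the box is vacuous for every value of `x` but the current one.
bind : DVar → Formula → Formula
bind x φ = ∀ᶠ x ([ ⋆ ≐ dvar x ] φ)

binds : List DVar → Formula → Formula
binds xs φ = foldr bind φ xs

-- sHML has no diamond. The truth of `b` is expressed by forbidding its negation, which is read back
-- classically.
check : Constraint → Formula → Formula
check b φ = [ ¬ᵇ b ] ffᶠ ∧ [ trueᵇ ] φ

skip : ℕ → Formula → Formula
skip zero    φ = φ
skip (suc n) φ = [ trueᵇ ] skip n φ

-- A substitute for `ttᶠ`, which sHML lacks.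
verum : Formula
verum = [ ¬ᵇ trueᵇ ] ffᶠ

-- Variables below 16 hold the fields of two blocks; see varIndex.
markVar : DVar
markVar = 16

atMark : Constraint
atMark = ⋆ ≐ dvar markVar

-- Skipping to the mark, rather than over a fixed number of constants, keeps
-- the preamble independent of M; otherwise the control states that emit the
-- preamble would make the preamble longer.
await : Formula → Formula
await φ = maxᶠ 0 ([ ¬ᵇ atMark ] fvar 0 ∧ [ atMark ] φ)

-- `await` stops at the first mark, so a constant equal to the mark would start the literal inside
-- the list of constants.
bindsUnmarked : List DVar → Formula → Formula
bindsUnmarked xs φ = foldr (λ x ψ → [ atMark ] ffᶠ ∧ bind x ψ) φ xs

-- Codes of these formula contexts

codeBind : DVar → List Token
codeBind x = all′ ∷ codeVar x ++ box′ ∷ eq′ ∷ star′ ∷ dvar′ ∷ codeVar x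

codeCheck : Constraint → List Token
codeCheck b =
  con′ ∷ box′ ∷ not′ ∷ codeConstraint b ++ ff′ ∷ box′ ∷ true′ ∷ []

codeSkip : ℕ → List Token
codeSkip zero    = []
codeSkip (suc n) = box′ ∷ true′ ∷ codeSkip n

codeAwait : List Token
codeAwait =
  max′ ∷ codeVar 0 ++ con′ ∷ codeFormula ([ ¬ᵇ atMark ] fvar 0) ++
  box′ ∷ codeConstraint atMark

code-binds : ∀ xs φ →
  codeFormula (binds xs φ) ≡ concatMap codeBind xs ++ codeFormula φ
code-binds []       φ = refl
code-binds (x ∷ xs) φ = begin
  all′ ∷ codeVar x ++ box′ ∷ eq′ ∷ star′ ∷ dvar′ ∷
    codeVar x ++ codeFormula (binds xs φ)
    ≡⟨ cong (all′ ∷_) (++-assoc (codeVar x) _ _) ⟨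
  codeBind x ++ codeFormula (binds xs φ)
    ≡⟨ cong (codeBind x ++_) (code-binds xs φ) ⟩
  codeBind x ++ concatMap codeBind xs ++ codeFormula φ
    ≡⟨ ++-assoc (codeBind x) _ _ ⟨
  concatMap codeBind (x ∷ xs) ++ codeFormula φ ∎
  where open ≡-Reasoning

code-check : ∀ b φ → codeFormula (check b φ) ≡ codeCheck b ++ codeFormula φ
code-check b φ = cong (λ w → con′ ∷ box′ ∷ not′ ∷ w)
  (trans (++-assoc (codeConstraint b) _ _) (sym (++-assoc (codeConstraint b) _ _)))

code-skip : ∀ n φ → codeFormula (skip n φ) ≡ codeSkip n ++ codeFormula φ
code-skip zero    φ = refl
code-skip (suc n) φ = cong (λ w → box′ ∷ true′ ∷ w) (code-skip n φ)

-- Membership in sHML, guardedness and scoping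

sHML-binds : ∀ xs {φ} → sHML φ → sHML (binds xs φ)
sHML-binds []       p = p
sHML-binds (x ∷ xs) p = ∀ˢ (boxˢ (sHML-binds xs p))

sHML-bindsUnmarked : ∀ xs {φ} → sHML φ → sHML (bindsUnmarked xs φ)
sHML-bindsUnmarked []       p = p
sHML-bindsUnmarked (x ∷ xs) p =
  boxˢ ffˢ ∧ˢ ∀ˢ (boxˢ (sHML-bindsUnmarked xs p))

sHML-check : ∀ {b φ} → sHML φ → sHML (check b φ)
sHML-check p = boxˢ ffˢ ∧ˢ boxˢ p

sHML-skip : ∀ n {φ} → sHML φ → sHML (skip n φ)
sHML-skip zero    p = p
sHML-skip (suc n) p = boxˢ (sHML-skip n p)

guarded-binds : ∀ xs φ → Guarded φ → Guarded (binds xs φ)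
guarded-binds []       φ g = g
guarded-binds (x ∷ xs) φ g = guarded-binds xs φ g

guarded-bindsUnmarked : ∀ xs φ → Guarded φ → Guarded (bindsUnmarked xs φ)
guarded-bindsUnmarked []       φ g = g
guarded-bindsUnmarked (x ∷ xs) φ g = tt , guarded-bindsUnmarked xs φ g

guarded-skip : ∀ n φ → Guarded φ → Guarded (skip n φ)
guarded-skip zero    φ g = g
guarded-skip (suc n) φ g = guarded-skip n φ g

⊆-shuffle : ∀ {A : Set} {v : A} vs {xs} → v ∷ vs ++ xs ⊆ vs ++ v ∷ xs
⊆-shuffle vs (here eq) = ∈-++⁺ʳ vs (here eq)
⊆-shuffle vs (there p) with ∈-++⁻ vs p
... | inj₁ q = ∈-++⁺ˡ q
... | inj₂ q = ∈-++⁺ʳ vs (there q)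

-- Each binder puts its variable in front, so `vs` ends up reversed; asking for `φ` in every larger
-- scope avoids tracking this order.
closed-binds : ∀ vs {xs} Xs φ →
  (∀ {ys} → vs ++ xs ⊆ ys → FormulaIn ys Xs φ) →
  FormulaIn xs Xs (binds vs φ)
closed-binds []       Xs φ h = h (λ p → p)
closed-binds (v ∷ vs) Xs φ h = (tt , here refl) ,
  closed-binds vs Xs φ λ sub → h λ p → sub (⊆-shuffle vs p)

closed-bindsUnmarked : ∀ vs {xs} Xs φ → markVar ∈ xs →
  (∀ {ys} → vs ++ xs ⊆ ys → FormulaIn ys Xs φ) →
  FormulaIn xs Xs (bindsUnmarked vs φ)
closed-bindsUnmarked []       Xs φ m h = h (λ p → p)
closed-bindsUnmarked (v ∷ vs) Xs φ m h =
  ((tt , m) , tt) , (tt , here refl) ,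
  closed-bindsUnmarked vs Xs φ (there m) λ sub → h λ p → sub (⊆-shuffle vs p)

closed-skip : ∀ n {xs} Xs φ → FormulaIn xs Xs φ → FormulaIn xs Xs (skip n φ)
closed-skip zero    Xs φ c = c
closed-skip (suc n) Xs φ c = tt , closed-skip n Xs φ c

-- Absorbing predicates along an iteration

module _ {A : Set} (f : A → A) (P Q : A → Set)
         (P⁺ : ∀ {x} → P x → P (f x)) (Q⁺ : ∀ {x} → Q x → Q (f x))
         (P#Q : ∀ {x} → P x → ¬ Q x) where

  -- Both counters run down together; the predicate reached first persists until the other is
  -- reached, where the two clash.
  absorbing-disjoint : ∀ m n x → P (iterate f x m) → ¬ Q (iterate f x n)
  absorbing-disjoint zero    zero    x p q = P#Q p q
  absorbing-disjoint zero    (suc n) x p q = absorbing-disjoint zero n (f x) (P⁺ p) q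
  absorbing-disjoint (suc m) zero    x p q = absorbing-disjoint m zero (f x) p (Q⁺ q)
  absorbing-disjoint (suc m) (suc n) x p q = absorbing-disjoint m n (f x) p q

accept-reject-disjoint : ∀ {Σ : Set} (M : TM Σ) {w} → Accepts M w → ¬ Rejects M w
accept-reject-disjoint M {w} (m , acc) (n , rej) = absorbing-disjoint (step M)
  (λ c → Config.state c ≡ accept) (λ c → Config.state c ≡ reject)
  (λ { {config _ _ _ _} refl → refl }) (λ { {config _ _ _ _} refl → refl })
  (λ p q → accept≢reject (trans (sym p) q)) m n (initial M w) acc rej
  where
  accept≢reject : ∀ {q} → accept {q} ≢ reject
  accept≢reject ()

-- The two-stack machine

data StackOp (Sym : Set) : Set where
  keep pop : StackOp Sym
  push     : Sym → StackOp Sym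

data HeadOp : Set where
  keep : HeadOp
  take : Move → HeadOp

data Field : Set where
  head state    : Field
  ptr top rest  : Move → Field

fieldIndex : Field → ℕ
fieldIndex head         = 0
fieldIndex state        = 1
fieldIndex (ptr left)   = 2
fieldIndex (top left)   = 3
fieldIndex (rest left)  = 4
fieldIndex (ptr right)  = 5
fieldIndex (top right)  = 6
fieldIndex (rest right) = 7

-- These are read at eight of the nine positions of a block; at the ninth,
-- constraints on them are checked.
oldVars newVars : List DVar
oldVars = upTo 8
newVars = applyUpTo (8 +_) 8

module Machine (M : TM Token) where
  open TM M using (q; k; start; δ)

  Sym : Set
  Sym = Symbol Token k

  -- load reads the literal; scan pops a token a off the left stack, and the
  -- reversed block of a is then pushed by emit; final pushes the reversed
  -- preamble and starts M.
  data Ctl : Set where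
    load scan  : Ctl
    emit final : List Token → Ctl
    tm         : State q → Ctl

  data Const : Set where
    symᶜ : Sym → Const
    ctlᶜ : Ctl → Const

  -- Numbering of the constants

  symList : Sym → List ℕ
  symList blank     = 0 ∷ []
  symList (input a) = 1 ∷ tokenIndex a ∷ []
  symList (work i)  = 2 ∷ toℕ i ∷ []

  stateList : State q → List ℕ
  stateList accept  = 0 ∷ []
  stateList reject  = 1 ∷ []
  stateList (run p) = 2 ∷ toℕ p ∷ []

  ctlList : Ctl → List ℕ
  ctlList load      = 0 ∷ []
  ctlList scan      = 1 ∷ []
  ctlList (emit w)  = 2 ∷ map tokenIndex w
  ctlList (final w) = 3 ∷ map tokenIndex w
  ctlList (tm s)    = 4 ∷ stateList s

  constList : Const → List ℕ
  constList (symᶜ a) = 0 ∷ symList a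
  constList (ctlᶜ p) = 1 ∷ ctlList p

  -- The leading number is a tag for the constructor, so the mixed cases are absurd.
  symList-injective : Injective _≡_ _≡_ symList
  symList-injective {blank}   {blank}   _  = refl
  symList-injective {input _} {input _} eq =
    cong input (tokenIndex-injective (∷-injectiveˡ (∷-injectiveʳ eq)))
  symList-injective {work _}  {work _}  eq =
    cong work (toℕ-injective (∷-injectiveˡ (∷-injectiveʳ eq)))

  stateList-injective : Injective _≡_ _≡_ stateList
  stateList-injective {accept} {accept} _  = refl
  stateList-injective {reject} {reject} _  = refl
  stateList-injective {run _}  {run _}  eq =
    cong run (toℕ-injective (∷-injectiveˡ (∷-injectiveʳ eq)))

  ctlList-injective : Injective _≡_ _≡_ ctlList
  ctlList-injective {load}    {load}    _  = refl
  ctlList-injective {scan}    {scan}    _  = refl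
  ctlList-injective {emit _}  {emit _}  eq =
    cong emit (map-injective tokenIndex-injective (∷-injectiveʳ eq))
  ctlList-injective {final _} {final _} eq =
    cong final (map-injective tokenIndex-injective (∷-injectiveʳ eq))
  ctlList-injective {tm _}    {tm _}    eq =
    cong tm (stateList-injective (∷-injectiveʳ eq))

  constList-injective : Injective _≡_ _≡_ constList
  constList-injective {symᶜ _} {symᶜ _} eq =
    cong symᶜ (symList-injective (∷-injectiveʳ eq))
  constList-injective {ctlᶜ _} {ctlᶜ _} eq =
    cong ctlᶜ (ctlList-injective (∷-injectiveʳ eq))

  -- The offset makes lookups of constants commute definitionally with binding
  -- fields and the mark.
  constVar : Const → DVar
  constVar c = 17 + listCode (constList c)

  constVar-injective : Injective _≡_ _≡_ constVar
  constVar-injective eq =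
    constList-injective (listCode-injective (+-cancelˡ-≡ 17 _ _ eq))

  symᶜ-injective : ∀ {a b} → symᶜ a ≡ symᶜ b → a ≡ b
  symᶜ-injective refl = refl

  ctlᶜ-injective : ∀ {p p′} → ctlᶜ p ≡ ctlᶜ p′ → p ≡ p′
  ctlᶜ-injective refl = refl

  -- The literal and its code

  atSym : Sym → Constraint
  atSym a = ⋆ ≐ dvar (constVar (symᶜ a))

  -- The checked position is the head field of a block.
  literal : List Token → Formula
  literal []      = check (atSym blank) verum
  literal (a ∷ u) = check (atSym (input a)) (skip 8 (literal u))

  baseConsts : List Const
  baseConsts = symᶜ blank ∷ map (symᶜ ∘ input) tokens

  baseVars : List DVar
  baseVars = markVar ∷ map constVar baseConsts

  block : Token → List Token
  block a = codeCheck (atSym (input a)) ++ codeSkip 8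

  preamble : List Token
  preamble = concatMap codeBind baseVars ++ con′ ∷ codeAwait

  code-literal : ∀ u →
    codeFormula (literal u) ≡ concatMap block u ++ codeFormula (literal [])
  code-literal []      = refl
  code-literal (a ∷ u) = begin
    codeFormula (literal (a ∷ u))
      ≡⟨ code-check (atSym (input a)) (skip 8 (literal u)) ⟩
    codeCheck (atSym (input a)) ++ codeFormula (skip 8 (literal u))
      ≡⟨ cong (codeCheck (atSym (input a)) ++_) (code-skip 8 (literal u)) ⟩
    codeCheck (atSym (input a)) ++ codeSkip 8 ++ codeFormula (literal u)
      ≡⟨ ++-assoc (codeCheck (atSym (input a))) _ _ ⟨
    block a ++ codeFormula (literal u)
      ≡⟨ cong (block a ++_) (code-literal u) ⟩
    block a ++ concatMap block u ++ codeFormula (literal [])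
      ≡⟨ ++-assoc (block a) _ _ ⟨
    concatMap block (a ∷ u) ++ codeFormula (literal []) ∎
    where open ≡-Reasoning

  -- Transition function of the two-stack machine

  data Action : Set where
    act : Ctl → (left right : StackOp Sym) → HeadOp → Action

  target : Action → Ctl
  target (act p _ _ _) = p

  opOn : Action → Move → StackOp Sym
  opOn (act _ o _ _) left  = o
  opOn (act _ _ o _) right = o

  headOp : Action → HeadOp
  headOp (act _ _ _ h) = h

  tmAction : State q × Sym × Move → Action
  tmAction (s , b , left)  = act (tm s) pop (push b) (take left)
  tmAction (s , b , right) = act (tm s) (push b) pop (take right)

  transition : Ctl → Sym → Action
  transition load            _         = act scan pop keep (take left)
  transition scan            (input a) = act (emit (reverse (block a))) keep keep keep
  -- A head other than a token signals that the left copy is used up.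
  transition scan            _         = act (final (reverse preamble)) keep keep keep
  transition (emit [])       _         = act scan pop keep (take left)
  transition (emit (x ∷ w))  _         = act (emit w) keep (push (input x)) keep
  transition (final [])      _         = act (tm start) keep pop (take right)
  transition (final (x ∷ w)) _         = act (final w) keep (push (input x)) keep
  transition (tm (run p))    a         = tmAction (δ p a)
  -- Halting states repeat themselves, so that every computation is infinite.
  transition (tm s)          _         = act (tm s) keep keep keep

  -- A finite set of control states closed under transitions

  syms : List Sym
  syms = blank ∷ map input tokens ++ map work (allFin k)

  ∈-syms : ∀ a → a ∈ syms
  ∈-syms blank     = here refl
  ∈-syms (input a) = there (∈-++⁺ˡ (∈-map⁺ input (∈-tokens a)))
  ∈-syms (work i)  =
    there (∈-++⁺ʳ (map input tokens) (∈-map⁺ work (∈-allFin i)))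

  -- Only suffixes of the emitted words are ever left to emit, so finitely many rules suffice.
  emitsOf : Token → List Ctl
  emitsOf a = map emit (tails (reverse (block a)))

  emits finals tms : List Ctl
  emits  = concatMap emitsOf tokens
  finals = map final (tails (reverse preamble))
  tms    = map tm (accept ∷ reject ∷ map run (allFin q))

  -- `load` is absent: on tokens it obeys `loadRule` instead of `transition`, and its rule on a
  -- blank is listed separately.
  ctls : List Ctl
  ctls = scan ∷ emits ++ finals ++ tms

  tails-suffix : ∀ {A : Set} {x : A} {xs} ys → x ∷ xs ∈ tails ys → xs ∈ tails ys
  tails-suffix []       (here ())
  tails-suffix []       (there ())
  tails-suffix (y ∷ ys) (here refl) = there (here refl)
  tails-suffix (y ∷ ys) (there p)   = there (tails-suffix ys p)

  emits⊆ : emits ⊆ ctls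
  emits⊆ p = there (∈-++⁺ˡ p)

  finals⊆ : finals ⊆ ctls
  finals⊆ p = there (∈-++⁺ʳ emits (∈-++⁺ˡ p))

  tm∈ : ∀ s → tm s ∈ ctls
  tm∈ s = there (∈-++⁺ʳ emits (∈-++⁺ʳ finals (∈-map⁺ tm (h s))))
    where
    h : ∀ s → s ∈ accept ∷ reject ∷ map run (allFin q)
    h accept  = here refl
    h reject  = there (here refl)
    h (run p) = there (there (∈-map⁺ run (∈-allFin p)))

  emit∈ : ∀ a {w} → w ∈ tails (reverse (block a)) → emit w ∈ ctls
  emit∈ a p = emits⊆
    (∈-concatMap⁺ emitsOf (lose (∈-tokens a) (∈-map⁺ emit p)))

  final∈ : ∀ {w} → w ∈ tails (reverse preamble) → final w ∈ ctls
  final∈ p = finals⊆ (∈-map⁺ final p)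

  Stays : Ctl → Set
  Stays p = ∀ a → target (transition p a) ∈ ctls

  tmAction-target : ∀ x → target (tmAction x) ∈ ctls
  tmAction-target (s , b , left)  = tm∈ s
  tmAction-target (s , b , right) = tm∈ s

  scan-closed : Stays scan
  scan-closed blank     = final∈ (here refl)
  scan-closed (input a) = emit∈ a (here refl)
  scan-closed (work i)  = final∈ (here refl)

  emit-closed : ∀ a {w} → w ∈ tails (reverse (block a)) → Stays (emit w)
  emit-closed a {[]}    p _ = here refl
  emit-closed a {x ∷ w} p _ = emit∈ a (tails-suffix _ p)

  final-closed : ∀ {w} → w ∈ tails (reverse preamble) → Stays (final w)
  final-closed {[]}    p _ = tm∈ start
  final-closed {x ∷ w} p _ = final∈ (tails-suffix _ p)

  tm-closed : ∀ s → Stays (tm s)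
  tm-closed accept  _ = tm∈ accept
  tm-closed reject  _ = tm∈ reject
  tm-closed (run p) a = tmAction-target (δ p a)

  ctls-closed : All Stays ctls
  ctls-closed = scan-closed ∷
    All.++⁺ (All.concat⁺ (All.map⁺ {f = emitsOf} (All.universal emitsOf-closed tokens)))
    (All.++⁺ (All.map⁺ {f = final} (All.tabulate final-closed))
             (All.map⁺ {f = tm} (All.universal tm-closed _)))
    where
    emitsOf-closed : ∀ a → All Stays (emitsOf a)
    emitsOf-closed a = All.map⁺ {f = emit} (All.tabulate (emit-closed a))

  -- Runs of the two-stack machine

  data Conf : Set where
    conf : Ctl → Sym → (left right : List Sym) → Conf

  topOf : List Sym → Sym
  topOf []      = blank
  topOf (a ∷ _) = a

  perform : StackOp Sym → List Sym → List Sym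
  perform keep     l = l
  perform pop      l = drop 1 l
  perform (push a) l = a ∷ l

  nextHead : HeadOp → Sym → (left right : List Sym) → Sym
  nextHead keep         a l r = a
  nextHead (take left)  a l r = topOf l
  nextHead (take right) a l r = topOf r

  execute : Action → Sym → (left right : List Sym) → Conf
  execute α a l r =
    conf (target α) (nextHead (headOp α) a l r)
         (perform (opOn α left) l) (perform (opOn α right) r)

  next : Conf → Conf
  next (conf p a l r) = execute (transition p a) a l r

  embed : Config M → Conf
  embed (config s ls h rs) = conf (tm s) h ls rs

  -- The stacks are split because `write-move` treats an exhausted side separately; there `topOf`
  -- and `drop 1` give the same blank and empty list.
  next-embed : ∀ c → next (embed c) ≡ embed (step M c)
  next-embed (config accept  ls h rs) = refl
  next-embed (config reject  ls h rs) = refl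
  next-embed (config (run p) ls h rs) with δ p h
  next-embed (config (run p) []       h rs)       | s , b , left  = refl
  next-embed (config (run p) (l ∷ ls) h rs)       | s , b , left  = refl
  next-embed (config (run p) ls       h [])       | s , b , right = refl
  next-embed (config (run p) ls       h (r ∷ rs)) | s , b , right = refl

  iterate-embed : ∀ n c → iterate next (embed c) n ≡ embed (iterate (step M) c n)
  iterate-embed zero    c = refl
  iterate-embed (suc n) c =
    trans (cong (λ d → iterate next d n) (next-embed c)) (iterate-embed n _)

  infix 4 _↠_
  _↠_ : Conf → Conf → Set
  c ↠ d = ∃[ n ] iterate next c n ≡ d

  ↠-step : ∀ {c d} → next c ↠ d → c ↠ d
  ↠-step (n , eq) = suc n , eq

  ↠-trans : ∀ {c d e} → c ↠ d → d ↠ e → c ↠ e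
  ↠-trans (zero  , refl) q = q
  ↠-trans {c} (suc n , eq) q = ↠-step (↠-trans {next c} (n , eq) q)

  emit-run : ∀ w {a l r} →
    conf (emit w) a l r ↠ conf scan (topOf l) (drop 1 l) (map input w ʳ++ r)
  emit-run []      = ↠-step (0 , refl)
  emit-run (x ∷ w) = ↠-step (emit-run w)

  final-run : ∀ w {a l r} →
    conf (final w) a l r ↠
    conf (tm start) (topOf (map input w ʳ++ r)) l (drop 1 (map input w ʳ++ r))
  final-run []      = ↠-step (0 , refl)
  final-run (x ∷ w) = ↠-step (final-run w)

  ʳ++-reverse : ∀ (w v : List Token) →
    map input (reverse w) ʳ++ map input v ≡ map {B = Sym} input (w ++ v)
  ʳ++-reverse w v = begin
    map input (reverse w) ʳ++ map input v ≡⟨ map-ʳ++ input (reverse w) ⟨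
    map input (reverse w ʳ++ v)           ≡⟨ cong (map input) (ʳ++-defn (reverse w)) ⟩
    map input (reverse (reverse w) ++ v)
      ≡⟨ cong (λ u → map input (u ++ v)) (reverse-involutive w) ⟩
    map input (w ++ v)                    ∎
    where open ≡-Reasoning

  concatMap-reverse : ∀ a (w v : List Token) →
    concatMap block (reverse w) ++ block a ++ v ≡
    concatMap block (reverse (a ∷ w)) ++ v
  concatMap-reverse a w v = begin
    concatMap block (reverse w) ++ block a ++ v
      ≡⟨ ++-assoc (concatMap block (reverse w)) (block a) v ⟨
    (concatMap block (reverse w) ++ block a) ++ v
      ≡⟨ cong (λ u → (concatMap block (reverse w) ++ u) ++ v) (++-identityʳ (block a)) ⟨
    (concatMap block (reverse w) ++ concatMap block (a ∷ [])) ++ v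
      ≡⟨ cong (_++ v) (concatMap-++ block (reverse w) (a ∷ [])) ⟨
    concatMap block (reverse w ++ a ∷ []) ++ v
      ≡⟨ cong (λ u → concatMap block u ++ v) (unfold-reverse a w) ⟨
    concatMap block (reverse (a ∷ w)) ++ v ∎
    where open ≡-Reasoning

  -- Each popped token puts its block in front of the earlier ones, so the blocks appear in the
  -- reverse of the order of `w`, which is the order of the literal.
  scan-run : ∀ w v →
    conf scan (topOf (map input w)) (drop 1 (map input w)) (map input v) ↠
    conf scan blank [] (map input (concatMap block (reverse w) ++ v))
  scan-run []      v = 0 , refl
  scan-run (a ∷ w) v = ↠-step (↠-trans (emit-run (reverse (block a)))
    (subst₂ (λ r u → conf scan (topOf (map input w)) (drop 1 (map input w)) r ↠
                     conf scan blank [] (map input u))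
            (sym (ʳ++-reverse (block a) v)) (concatMap-reverse a w v)
            (scan-run w (block a ++ v))))

  initialConf : ∀ w →
    conf (tm start) (topOf (map input w)) [] (drop 1 (map input w)) ≡
    embed (initial M w)
  initialConf []      = refl
  initialConf (a ∷ w) = refl

  -- The right copy of `w` stays as the end of the tape; the blocks and then the preamble go in
  -- front of it. For `w = tape` the result is the code of the formula, by `code-run-on`.
  quine-run : ∀ w →
    conf load blank (map input w) (map input w) ↠
    embed (initial M (preamble ++ concatMap block (reverse w) ++ w))
  quine-run w = ↠-step (↠-trans (scan-run w w) (↠-step
    (subst (conf (final (reverse preamble)) blank [] (map input v) ↠_)
           (trans (cong (λ r → conf (tm start) (topOf r) [] (drop 1 r))
                        (ʳ++-reverse preamble v))
                  (initialConf (preamble ++ v)))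
           (final-run (reverse preamble)))))
    where v = concatMap block (reverse w) ++ w

  -- The formula

  data Var : Set where
    old new : Field → Var
    const   : Const → Var

  varIndex : Var → DVar
  varIndex (old f)   = fieldIndex f
  varIndex (new f)   = 8 + fieldIndex f
  varIndex (const c) = constVar c

  Eqs : Set
  Eqs = List (Var × Var)

  infix 4 _⇒_
  data Clause : Set where
    _⇒_   : Eqs → Eqs → Clause
    never : Eqs → Clause

  eqs : Eqs → Constraint
  eqs []             = trueᵇ
  eqs ((x , y) ∷ es) = dvar (varIndex x) ≐ dvar (varIndex y) ∧ᵇ eqs es

  clause : Clause → Constraint
  clause (g ⇒ e)   = ¬ᵇ (eqs g ∧ᵇ ¬ᵇ eqs e)
  clause (never g) = ¬ᵇ eqs g

  clauses : List Clause → Constraint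
  clauses []       = trueᵇ
  clauses (c ∷ cs) = clause c ∧ᵇ clauses cs

  ctlConst : Ctl → Var
  ctlConst p = const (ctlᶜ p)

  symConst : Sym → Var
  symConst a = const (symᶜ a)

  -- A push fixes the contents of the new top cell and leaves its name open. A pop moves to the name
  -- of the cell below, whose contents then follow from `consistency`.
  stackEqs : Move → StackOp Sym → Eqs
  stackEqs s keep     = (new (ptr s) , old (ptr s)) ∷ []
  stackEqs s pop      = (new (ptr s) , old (rest s)) ∷ []
  stackEqs s (push a) =
    (new (top s) , symConst a) ∷ (new (rest s) , old (ptr s)) ∷ []

  headEqs : HeadOp → Eqs
  headEqs keep     = (new head , old head) ∷ []
  headEqs (take s) = (new head , old (top s)) ∷ []

  at : Ctl → Sym → Eqs
  at p a = (old state , ctlConst p) ∷ (old head , symConst a) ∷ []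

  effect : Action → Eqs
  effect α =
    (new state , ctlConst (target α)) ∷ headEqs (headOp α) ++
    stackEqs left (opOn α left) ++ stackEqs right (opOn α right)

  rule : Ctl → Sym → Clause
  rule p a = at p a ⇒ effect (transition p a)

  -- The next head symbol is left open: it is supplied by the literal.
  loadRule : Token → Clause
  loadRule a = at load (input a) ⇒
    (new state , ctlConst load) ∷
    stackEqs left (push (input a)) ++ stackEqs right (push (input a))

  rules : List Clause
  rules =
    never ((old state , ctlConst (tm reject)) ∷ []) ∷
    -- This clause is violated by every eventually constant trace.
    never ((old state , old head) ∷ []) ∷
    rule load blank ∷
    map loadRule tokens ++ cartesianProductWith rule ctls syms

  sameCell : Move → Clause
  sameCell s = (old (ptr s) , new (ptr s)) ∷ [] ⇒
    (old (top s) , new (top s)) ∷ (old (rest s) , new (rest s)) ∷ []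

  consistency : List Clause
  consistency = sameCell left ∷ sameCell right ∷ []

  -- A bottom cell that contains a blank and points to itself represents the
  -- infinitely many blanks of the tape.
  emptyEqs : Move → Eqs
  emptyEqs s = (old (top s) , symConst blank) ∷ (old (rest s) , old (ptr s)) ∷ []

  initially : List Clause
  initially =
    ([] ⇒ (old state , ctlConst load) ∷ emptyEqs left ++ emptyEqs right) ∷ []

  checkNext : List Clause → Formula → Formula
  checkNext cs φ = binds newVars (check (clauses cs) φ)

  readOld : Formula → Formula
  readOld φ = binds oldVars (skip 1 φ)

  -- The outer fixed point of `always` visits every block; the inner one compares it with each later
  -- block, keeping the `old` variables and rebinding the `new` ones.
  starts always : Formula
  starts = readOld (checkNext initially verum)
  always = maxᶠ 0 (readOld (fvar 0 ∧ checkNext rules verum ∧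
                            maxᶠ 1 (checkNext consistency (fvar 1))))

  extraConsts : List Const
  extraConsts =
    map (symᶜ ∘ work) (allFin k) ++ map ctlᶜ (load ∷ ctls)

  extraVars : List DVar
  extraVars = map constVar extraConsts

  simulation : Formula
  simulation = bindsUnmarked extraVars (check atMark (starts ∧ always))

  -- Both conjuncts start at the same position: one skips to the mark and reads the literal, the
  -- other binds the remaining constants up to that same mark.
  run-on : List DVar → List Token → Formula
  run-on xs u = binds xs (await (literal u) ∧ simulation)

  tape : List Token
  tape = codeFormula (literal []) ++ codeFormula simulation

  -- The equation behind the quine: for `xs = baseVars` the first part is `preamble`, and neither it
  -- nor `tape` depends on `u`, so choosing `u = reverse tape` is not circular.
  code-run-on : ∀ xs u → codeFormula (run-on xs u) ≡
    (concatMap codeBind xs ++ con′ ∷ codeAwait) ++ concatMap block u ++ tape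
  code-run-on xs u = begin
    codeFormula (run-on xs u)
      ≡⟨ code-binds xs (await (literal u) ∧ simulation) ⟩
    concatMap codeBind xs ++ (con′ ∷ codeAwait) ++
      codeFormula (literal u) ++ codeFormula simulation
      ≡⟨ ++-assoc (concatMap codeBind xs) (con′ ∷ codeAwait) _ ⟨
    pre ++ codeFormula (literal u) ++ codeFormula simulation
      ≡⟨ cong (λ w → pre ++ w ++ codeFormula simulation) (code-literal u) ⟩
    pre ++ (concatMap block u ++ codeFormula (literal [])) ++
      codeFormula simulation
      ≡⟨ cong (pre ++_) (++-assoc (concatMap block u) _ _) ⟩
    pre ++ concatMap block u ++ tape ∎
    where
    open ≡-Reasoning
    pre = concatMap codeBind xs ++ con′ ∷ codeAwait

  -- The formula is in sHML, guarded and closed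

  sHML-literal : ∀ u → sHML (literal u)
  sHML-literal []      = sHML-check (boxˢ ffˢ)
  sHML-literal (a ∷ u) = sHML-check (sHML-skip 8 (sHML-literal u))

  sHML-checkNext : ∀ cs {φ} → sHML φ → sHML (checkNext cs φ)
  sHML-checkNext cs p = sHML-binds newVars (sHML-check p)

  sHML-readOld : ∀ {φ} → sHML φ → sHML (readOld φ)
  sHML-readOld p = sHML-binds oldVars (boxˢ p)

  sHML-run-on : ∀ xs u → sHML (run-on xs u)
  sHML-run-on xs u = sHML-binds xs
    (maxˢ (boxˢ fvarˢ ∧ˢ boxˢ (sHML-literal u)) ∧ˢ
     sHML-bindsUnmarked extraVars (sHML-check
       (sHML-readOld (sHML-checkNext initially (boxˢ ffˢ)) ∧ˢ
        maxˢ (sHML-readOld (fvarˢ ∧ˢ (sHML-checkNext rules (boxˢ ffˢ) ∧ˢ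
          maxˢ (sHML-checkNext consistency fvarˢ)))))))

  guarded-literal : ∀ u → Guarded (literal u)
  guarded-literal []      = tt , tt
  guarded-literal (a ∷ u) = tt , guarded-skip 8 (literal u) (guarded-literal u)

  guarded-run-on : ∀ xs u → Guarded (run-on xs u)
  guarded-run-on xs u = guarded-binds xs (await (literal u) ∧ simulation)
    (((λ ()) , guarded-literal u) ,
     guarded-bindsUnmarked extraVars (check atMark (starts ∧ always))
       (tt , (tt , tt) , (λ ()) , (tt , tt) , tt , (λ ())))

  allConsts : List Const
  allConsts = baseConsts ++ extraConsts

  sym∈ : ∀ a → symᶜ a ∈ allConsts
  sym∈ blank     = here refl
  sym∈ (input a) = there (∈-++⁺ˡ (∈-map⁺ (symᶜ ∘ input) (∈-tokens a)))
  sym∈ (work i)  = ∈-++⁺ʳ baseConsts (∈-++⁺ˡ (∈-map⁺ (symᶜ ∘ work) (∈-allFin i)))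

  ctl∈ : ∀ {p} → p ∈ load ∷ ctls → ctlᶜ p ∈ allConsts
  ctl∈ m = ∈-++⁺ʳ baseConsts
    (∈-++⁺ʳ (map (symᶜ ∘ work) (allFin k)) (∈-map⁺ ctlᶜ m))

  InScope : Var → Set
  InScope (old _)   = ⊤
  InScope (new _)   = ⊤
  InScope (const c) = c ∈ allConsts

  EqsInScope : Eqs → Set
  EqsInScope = All (λ (x , y) → InScope x × InScope y)

  ClauseInScope : Clause → Set
  ClauseInScope (g ⇒ e)   = EqsInScope g × EqsInScope e
  ClauseInScope (never g) = EqsInScope g

  stackEqs-scope : ∀ s o → EqsInScope (stackEqs s o)
  stackEqs-scope s keep     = _ ∷ []
  stackEqs-scope s pop      = _ ∷ []
  stackEqs-scope s (push a) = (tt , sym∈ a) ∷ _ ∷ []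

  headEqs-scope : ∀ h → EqsInScope (headEqs h)
  headEqs-scope keep     = _ ∷ []
  headEqs-scope (take s) = _ ∷ []

  at-scope : ∀ {p} a → p ∈ load ∷ ctls → EqsInScope (at p a)
  at-scope a m = (tt , ctl∈ m) ∷ (tt , sym∈ a) ∷ []

  rule-scope : ∀ {p a} → p ∈ load ∷ ctls → target (transition p a) ∈ ctls →
    ClauseInScope (rule p a)
  rule-scope {p} {a} m m′ = at-scope a m ,
    (tt , ctl∈ (there m′)) ∷ All.++⁺ (headEqs-scope (headOp α))
      (All.++⁺ (stackEqs-scope left (opOn α left))
               (stackEqs-scope right (opOn α right)))
    where α = transition p a

  loadRule-scope : ∀ a → ClauseInScope (loadRule a)
  loadRule-scope a = at-scope (input a) (here refl) ,
    (tt , ctl∈ (here refl)) ∷ (tt , sym∈ (input a)) ∷ _ ∷ (tt , sym∈ (input a)) ∷ _ ∷ []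

  rules-scope : All ClauseInScope rules
  rules-scope =
    ((tt , ctl∈ (there (tm∈ reject))) ∷ []) ∷ (_ ∷ []) ∷
    rule-scope {a = blank} (here refl) (here refl) ∷
    All.++⁺ (All.map⁺ {f = loadRule} (All.universal loadRule-scope tokens))
      (All.cartesianProductWith⁺ (setoid Ctl) (setoid Sym) rule ctls syms
        λ {p} {a} m _ → rule-scope {p} {a} (there m) (All.lookup ctls-closed m a))

  consistency-scope : All ClauseInScope consistency
  consistency-scope = (_ ∷ [] , _ ∷ _ ∷ []) ∷ (_ ∷ [] , _ ∷ _ ∷ []) ∷ []

  initially-scope : All ClauseInScope initially
  initially-scope =
    ([] , (tt , ctl∈ (here refl)) ∷ (tt , sym∈ blank) ∷ _ ∷ (tt , sym∈ blank) ∷ _ ∷ []) ∷ []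

  BindsConsts : List DVar → Set
  BindsConsts xs = map constVar allConsts ⊆ xs

  module _ {xs : List DVar} (sc : ∀ {v} → InScope v → varIndex v ∈ xs) where

    closed-eqs : ∀ {es} → EqsInScope es → ConstraintIn xs (eqs es)
    closed-eqs []             = tt
    closed-eqs ((p , p′) ∷ ps) = (sc p , sc p′) , closed-eqs ps

    closed-clauses : ∀ {cs} → All ClauseInScope cs → ConstraintIn xs (clauses cs)
    closed-clauses []                          = tt
    closed-clauses {(_ ⇒ _) ∷ _} ((g , e) ∷ ps) =
      (closed-eqs g , closed-eqs e) , closed-clauses ps
    closed-clauses {never _ ∷ _} (g ∷ ps)       = closed-eqs g , closed-clauses ps

  old∈ : ∀ f → fieldIndex f ∈ oldVars
  old∈ head         = here refl
  old∈ state        = there (here refl)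
  old∈ (ptr left)   = there (there (here refl))
  old∈ (top left)   = there (there (there (here refl)))
  old∈ (rest left)  = there (there (there (there (here refl))))
  old∈ (ptr right)  = there (there (there (there (there (here refl)))))
  old∈ (top right)  = there (there (there (there (there (there (here refl))))))
  old∈ (rest right) = there (there (there (there (there (there (there (here refl)))))))

  new∈ : ∀ f → 8 + fieldIndex f ∈ newVars
  new∈ f = ∈-map⁺ (8 +_) (old∈ f)

  closed-checkNext : ∀ {cs xs} Xs φ → All ClauseInScope cs →
    oldVars ⊆ xs → BindsConsts xs →
    (∀ {ys} → xs ⊆ ys → FormulaIn ys Xs φ) →
    FormulaIn xs Xs (checkNext cs φ)
  closed-checkNext {cs} Xs φ sc o b h =
    closed-binds newVars Xs (check (clauses cs) φ) λ {ys} sub →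
      let scope : ∀ {v} → InScope v → varIndex v ∈ ys
          scope = λ { {old f} _ → sub (∈-++⁺ʳ newVars (o (old∈ f)))
                    ; {new f} _ → sub (∈-++⁺ˡ (new∈ f))
                    ; {const c} m → sub (∈-++⁺ʳ newVars (b (∈-map⁺ constVar m))) }
      in (closed-clauses scope sc , tt) , tt , h λ p → sub (∈-++⁺ʳ newVars p)

  closed-readOld : ∀ {xs} Xs φ →
    (∀ {ys} → oldVars ⊆ ys → xs ⊆ ys → FormulaIn ys Xs φ) →
    FormulaIn xs Xs (readOld φ)
  closed-readOld Xs φ h = closed-binds oldVars Xs (skip 1 φ) λ sub →
    tt , h (λ p → sub (∈-++⁺ˡ p)) (λ p → sub (∈-++⁺ʳ oldVars p))

  closed-starts : ∀ {xs} Xs → BindsConsts xs → FormulaIn xs Xs starts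
  closed-starts Xs b = closed-readOld Xs (checkNext initially verum) λ o s →
    closed-checkNext Xs verum initially-scope o (λ p → s (b p)) λ _ → tt , tt

  closed-always : ∀ {xs} Xs → BindsConsts xs → FormulaIn xs Xs always
  closed-always Xs b =
    closed-readOld (0 ∷ Xs) (fvar 0 ∧ checkNext rules verum ∧
                             maxᶠ 1 (checkNext consistency (fvar 1))) λ o s →
      here refl ,
      closed-checkNext (0 ∷ Xs) verum rules-scope o (λ p → s (b p)) (λ _ → tt , tt) ,
      closed-checkNext (1 ∷ 0 ∷ Xs) (fvar 1) consistency-scope o (λ p → s (b p))
        (λ _ → here refl)

  closed-literal : ∀ u {xs} Xs → map constVar baseConsts ⊆ xs →
    FormulaIn xs Xs (literal u)
  closed-literal []      Xs b = ((tt , b (here refl)) , tt) , tt , tt , tt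
  closed-literal (a ∷ u) Xs b =
    ((tt , b (there (∈-map⁺ constVar (∈-map⁺ (symᶜ ∘ input) (∈-tokens a))))) , tt) ,
    tt , closed-skip 8 Xs (literal u) (closed-literal u Xs b)

  closed-simulation : ∀ {xs} → baseVars ⊆ xs → FormulaIn xs [] simulation
  closed-simulation b =
    closed-bindsUnmarked extraVars [] (check atMark (starts ∧ always))
      (b (here refl)) λ {ys} sub →
        let c : BindsConsts ys
            c = λ {x} p → [ (λ r → sub (∈-++⁺ʳ extraVars (b (there r)))) ,
                            (λ r → sub (∈-++⁺ˡ r)) ]′
                  (∈-++⁻ (map constVar baseConsts)
                    (subst (x ∈_) (map-++ constVar baseConsts extraConsts) p))
        in ((tt , sub (∈-++⁺ʳ extraVars (b (here refl)))) , tt) , tt ,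
           closed-starts [] c , closed-always [] c

  closed-run-on : ∀ {xs} u → baseVars ⊆ xs → Closed (run-on xs u)
  closed-run-on {xs} u base⊆ =
    closed-binds xs [] (await (literal u) ∧ simulation) λ {ys} sub →
      let b : baseVars ⊆ ys
          b = λ p → sub (∈-++⁺ˡ (base⊆ p))
      in (((tt , b (here refl)) , here refl) ,
          ((tt , b (here refl)) , closed-literal u _ (λ p → b (there p)))) ,
         closed-simulation b

  -- Separation of constants and of rules

  IsBase : Const → Set
  IsBase (symᶜ (work _)) = ⊥
  IsBase (symᶜ _)        = ⊤
  IsBase (ctlᶜ _)        = ⊥

  base-isBase : All IsBase baseConsts
  base-isBase = tt ∷ All.map⁺ {f = symᶜ ∘ input} (All.universal (λ _ → tt) tokens)

  extra-notBase : All (¬_ ∘ IsBase) extraConsts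
  extra-notBase = All.++⁺
    (All.map⁺ {f = symᶜ ∘ work} (All.universal (λ _ ()) (allFin k)))
    (All.map⁺ {f = ctlᶜ} (All.universal (λ _ ()) (load ∷ ctls)))

  -- The literal is read before the extra constants are bound, the rules afterwards. Both see the
  -- same base constants because no later binding overwrites one.
  base∉extra : ∀ {c} → c ∈ baseConsts → constVar c ∉ extraVars
  base∉extra m m′ with ∈-map⁻ constVar m′
  ... | d , d∈ , eq with constVar-injective eq
  ... | refl = All.lookup extra-notBase d∈ (All.lookup base-isBase m)

  -- Otherwise `rules` would send `load` on a token to `scan`, against `loadRule`.
  load∉ctls : load ∉ ctls
  load∉ctls m = All.lookup notLoad m refl
    where
    notLoad : All (_≢ load) ctls
    notLoad = (λ ()) ∷
      All.++⁺ (All.concat⁺ (All.map⁺ {f = emitsOf} (All.universal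
                (λ a → All.map⁺ {f = emit}
                  (All.universal (λ _ ()) (tails (reverse (block a))))) tokens)))
      (All.++⁺ (All.map⁺ {f = final} (All.universal (λ _ ()) (tails (reverse preamble))))
               (All.map⁺ {f = tm} (All.universal (λ _ ()) (accept ∷ reject ∷ map run (allFin q)))))

  rule∈ : ∀ {p} a → p ∈ ctls → rule p a ∈ rules
  rule∈ a m = there (there (there (∈-++⁺ʳ (map loadRule tokens)
    (∈-cartesianProductWith⁺ rule m (∈-syms a)))))

  loadRule∈ : ∀ a → loadRule a ∈ rules
  loadRule∈ a = there (there (there (∈-++⁺ˡ (∈-map⁺ loadRule (∈-tokens a)))))

  -- Runs with their loading phase

  Ready : Conf → Set
  Ready (conf p a _ _) = p ∈ ctls ⊎ (p ≡ load × a ≡ blank)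

  ready-rule : ∀ {p a l r} → Ready (conf p a l r) → rule p a ∈ rules
  ready-rule {a = a} (inj₁ m)        = rule∈ a m
  ready-rule (inj₂ (refl , refl)) = there (there (here refl))

  ready-next : ∀ {c} → Ready c → Ready (next c)
  ready-next {conf p a l r} (inj₁ m)             = inj₁ (All.lookup ctls-closed m a)
  ready-next {conf p a l r} (inj₂ (refl , refl)) = inj₁ (here refl)

  ctlOf : Conf → Ctl
  ctlOf (conf p _ _ _) = p

  stackOf : Conf → Move → List Sym
  stackOf (conf _ _ l _) left  = l
  stackOf (conf _ _ _ r) right = r

  halted-next : ∀ {s c} → (∀ a → transition (tm s) a ≡ act (tm s) keep keep keep) →
    ctlOf c ≡ tm s → ctlOf (next c) ≡ tm s
  halted-next {c = conf _ a l r} eq refl = cong target (eq a)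

  -- Loading is never re-entered, so after one step the condition of `moving` holds vacuously.
  not-load : ∀ p a → target (transition p a) ≢ load
  not-load (tm (run p)) a eq = tmAction-not-load (δ p a) eq
    where
    tmAction-not-load : ∀ x → target (tmAction x) ≢ load
    tmAction-not-load (s , b , left)  ()
    tmAction-not-load (s , b , right) ()
  not-load load            _         ()
  not-load scan            blank     ()
  not-load scan            (input _) ()
  not-load scan            (work _)  ()
  not-load (emit [])       _         ()
  not-load (emit (_ ∷ _))  _         ()
  not-load (final [])      _         ()
  not-load (final (_ ∷ _)) _         ()
  not-load (tm accept)     _         ()
  not-load (tm reject)     _         ()

  infix 4 _⟶_
  data _⟶_ : Conf → Conf → Set where
    loading : ∀ {a b l r} →
      conf load (input a) l r ⟶ conf load b (input a ∷ l) (input a ∷ r)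
    moving  : ∀ {p a l r} → (p ≡ load → a ≡ blank) →
      conf p a l r ⟶ next (conf p a l r)

  loaded : List Token → List Sym → Conf
  loaded u l = conf load blank (map input u ʳ++ l) (map input u ʳ++ l)

  runFrom : List Token → List Sym → ℕ → Conf
  runFrom []      l n       = iterate next (conf load blank l l) n
  runFrom (a ∷ u) l zero    = conf load (input a) l l
  runFrom (a ∷ u) l (suc n) = runFrom u (input a ∷ l) n

  iterate-step : ∀ n {p a l r} → (p ≡ load → a ≡ blank) →
    iterate next (conf p a l r) n ⟶ iterate next (conf p a l r) (suc n)
  iterate-step zero    h = moving h
  iterate-step (suc n) {p} {a} h =
    iterate-step n λ eq → contradiction eq (not-load p a)

  runFrom-step : ∀ u l n → runFrom u l n ⟶ runFrom u l (suc n)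
  runFrom-step []          l n       = iterate-step n λ _ → refl
  runFrom-step (a ∷ [])    l zero    = loading
  runFrom-step (a ∷ b ∷ u) l zero    = loading
  runFrom-step (a ∷ u)     l (suc n) = runFrom-step u (input a ∷ l) n

  runFrom-reject : ∀ u l n → ctlOf (runFrom u l n) ≡ tm reject →
    ∃[ m ] ctlOf (iterate next (loaded u l) m) ≡ tm reject
  runFrom-reject []      l n       eq = n , eq
  runFrom-reject (a ∷ u) l (suc n) eq = runFrom-reject u (input a ∷ l) n eq

  -- Loading reverses the literal, so after `reverse w` both stacks hold `w`.
  tm-run : ∀ {s} w → Reaches M s (preamble ++ concatMap block (reverse w) ++ w) →
    ∃[ n ] ctlOf (iterate next (loaded (reverse w) []) n) ≡ tm s
  tm-run {s} w (n , eq) =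
    proj₁ reach , trans (cong ctlOf (proj₂ reach)) (cong tm eq)
    where
    stacks : map input (reverse w) ʳ++ [] ≡ map {B = Sym} input w
    stacks = trans (ʳ++-reverse w []) (cong (map input) (++-identityʳ w))
    code = preamble ++ concatMap block (reverse w) ++ w
    final-conf = embed (iterate (step M) (initial M code) n)
    reach : loaded (reverse w) [] ↠ final-conf
    reach = subst (λ l → conf load blank l l ↠ final-conf) (sym stacks)
      (↠-trans (quine-run w) (n , iterate-embed n (initial M code)))

-- Semantics of the building blocks

module Semantics (em : ExcludedMiddle (Level.suc 0ℓ)) (𝔻 : Set) (𝔻↔ℕ : 𝔻 ↔ ℕ) where
  open Logic em 𝔻 𝔻↔ℕ hiding (_⊆_; MonitorableSat; EffectivelyMonitorableSat)
  open Equivalence using (to; from)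

  ¬¬-elim : {P : Set} → ¬ ¬ P → P
  ¬¬-elim {P} ¬¬p with em {Lift _ P}
  ... | yes p = lower p
  ... | no ¬p = contradiction (λ p → ¬p (lift p)) ¬¬p

  lookup-here : ∀ x {d δ} → lookup ((x , d) ∷ δ) x ≡ just d
  lookup-here x with x ≟ x
  ... | yes _  = refl
  ... | no x≢x = contradiction refl x≢x

  lookup-there : ∀ {x y d δ} → x ≢ y → lookup ((y , d) ∷ δ) x ≡ lookup δ x
  lookup-there {x} {y} x≢y with x ≟ y
  ... | yes x≡y = contradiction x≡y x≢y
  ... | no _    = refl

  shift : ℕ → Trc → Trc
  shift zero    t = t
  shift (suc n) t = shift n (t ∘ suc)

  extend : List DVar → Trc → DEnv → DEnv
  extend []       t δ = δ
  extend (x ∷ xs) t δ = extend xs (t ∘ suc) ((x , t 0) ∷ δ)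

  holds-≐ : ∀ {δ d e f v w} → value δ d e ≡ just v → value δ d f ≡ just w →
    Holds δ d (e ≐ f) ⇔ v ≡ w
  holds-≐ p q = mk⇔
    (λ (_ , p′ , q′) → just-injective
      (trans (sym p) (trans p′ (trans (sym q′) q))))
    (λ v≡w → _ , p , trans q (cong just (sym v≡w)))

  module _ {ρ : TEnv} where

    verum-true : ∀ {δ t} → ⟦ verum ⟧ ρ δ t
    verum-true f = f tt

    bind⇔ : ∀ x φ δ t →
      ⟦ bind x φ ⟧ ρ δ t ⇔ ⟦ φ ⟧ ρ ((x , t 0) ∷ δ) (t ∘ suc)
    bind⇔ x φ δ t = mk⇔
      (λ h → h (t 0) (t 0 , refl , lookup-here x))
      (λ h d (v , p , q) → subst
        (λ e → ⟦ φ ⟧ ρ ((x , e) ∷ δ) (t ∘ suc))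
        (just-injective (trans p (trans (sym q) (lookup-here x)))) h)

    binds⇔ : ∀ xs φ δ t →
      ⟦ binds xs φ ⟧ ρ δ t ⇔ ⟦ φ ⟧ ρ (extend xs t δ) (shift (length xs) t)
    binds⇔ []       φ δ t = ⇔.refl
    binds⇔ (x ∷ xs) φ δ t =
      ⇔.trans (bind⇔ x (binds xs φ) δ t) (binds⇔ xs φ ((x , t 0) ∷ δ) (t ∘ suc))

    check⇔ : ∀ b φ δ t →
      ⟦ check b φ ⟧ ρ δ t ⇔ (Holds δ (t 0) b × ⟦ φ ⟧ ρ δ (t ∘ suc))
    check⇔ b φ δ t = mk⇔
      (λ (h , p) → ¬¬-elim h , p tt)
      (λ (h , p) → (λ ¬h → ¬h h) , λ _ → p)

    skip⇔ : ∀ n φ δ t → ⟦ skip n φ ⟧ ρ δ t ⇔ ⟦ φ ⟧ ρ δ (shift n t)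
    skip⇔ zero    φ δ t = ⇔.refl
    skip⇔ (suc n) φ δ t = ⇔.trans (mk⇔ (λ h → h tt) (λ h _ → h)) (skip⇔ n φ δ (t ∘ suc))

  max-unfold : ∀ X φ ρ {δ t} → ⟦ maxᶠ X φ ⟧ ρ δ t →
    ⟦ φ ⟧ (ρ [ X ↦ ⟦ maxᶠ X φ ⟧ ρ ]) δ t
  max-unfold X φ ρ = proj₂ (proj₁ (⟦max⟧ X φ ρ)) _ _

  max-intro : ∀ X φ ρ (F : Interp) →
    (∀ δ t → F δ t → ⟦ φ ⟧ (ρ [ X ↦ F ]) δ t) →
    ∀ {δ t} → F δ t → ⟦ maxᶠ X φ ⟧ ρ δ t
  max-intro X φ ρ F post p = fromWitness (F , post , p)

  -- Blocks and environments

  Block : Set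
  Block = Field → 𝔻

  blockAt : Trc → ℕ → Block
  blockAt t zero    f = t (fieldIndex f)
  blockAt t (suc i) f = blockAt (shift 9 t) i f

  Old : Block → DEnv → Set
  Old B δ = ∀ f → lookup δ (fieldIndex f) ≡ just (B f)

  old-extend : ∀ t δ → Old (blockAt t 0) (extend oldVars t δ)
  old-extend t δ head         = refl
  old-extend t δ state        = refl
  old-extend t δ (ptr left)   = refl
  old-extend t δ (top left)   = refl
  old-extend t δ (rest left)  = refl
  old-extend t δ (ptr right)  = refl
  old-extend t δ (top right)  = refl
  old-extend t δ (rest right) = refl

  old-keep : ∀ {B δ} t → Old B δ → Old B (extend newVars t δ)
  old-keep t o head         = o head
  old-keep t o state        = o state
  old-keep t o (ptr left)   = o (ptr left)
  old-keep t o (top left)   = o (top left)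
  old-keep t o (rest left)  = o (rest left)
  old-keep t o (ptr right)  = o (ptr right)
  old-keep t o (top right)  = o (top right)
  old-keep t o (rest right) = o (rest right)

  new-extend : ∀ t δ f → lookup (extend newVars t δ) (8 + fieldIndex f) ≡ just (blockAt t 0 f)
  new-extend t δ head         = refl
  new-extend t δ state        = refl
  new-extend t δ (ptr left)   = refl
  new-extend t δ (top left)   = refl
  new-extend t δ (rest left)  = refl
  new-extend t δ (ptr right)  = refl
  new-extend t δ (top right)  = refl
  new-extend t δ (rest right) = refl

  Reads : (DVar → 𝔻 → Set) → List DVar → Trc → Set
  Reads P []       t = ⊤
  Reads P (x ∷ xs) t = P x (t 0) × Reads P xs (t ∘ suc)

  -- A variable may be bound repeatedly and the last binding counts, so the invariant is that a good
  -- binding is present or still to come.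
  extend-reads : ∀ {P x} xs {t δ} → Reads P xs t →
    x ∈ xs ⊎ (∃[ d ] lookup δ x ≡ just d × P x d) →
    ∃[ d ] lookup (extend xs t δ) x ≡ just d × P x d
  extend-reads []       r       (inj₂ b) = b
  extend-reads (y ∷ xs) (p , r) (inj₁ (here refl)) =
    extend-reads xs r (inj₂ (_ , lookup-here y , p))
  extend-reads (y ∷ xs) (p , r) (inj₁ (there q)) = extend-reads xs r (inj₁ q)
  extend-reads {x = x} (y ∷ xs) {t} {δ} (p , r) (inj₂ (d , eq , pd)) with x ≟ y
  ... | yes refl = extend-reads xs r (inj₂ (_ , lookup-here y , p))
  ... | no x≢y   = extend-reads xs r (inj₂ (d , trans (lookup-there x≢y) eq , pd))

  reads-any : ∀ xs t → Reads (λ _ _ → ⊤) xs t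
  reads-any []       t = tt
  reads-any (x ∷ xs) t = tt , reads-any xs (t ∘ suc)

  extend-other : ∀ {x} xs {t δ} → x ∉ xs → lookup (extend xs t δ) x ≡ lookup δ x
  extend-other []       x∉ = refl
  extend-other (y ∷ xs) x∉ =
    trans (extend-other xs (x∉ ∘ there)) (lookup-there (x∉ ∘ here))

  MarkAt : 𝔻 → ℕ → Trc → Set
  MarkAt m zero    t = t 0 ≡ m
  MarkAt m (suc n) t = t 0 ≢ m × MarkAt m n (t ∘ suc)

  atMark⇔ : ∀ δ d {m} → lookup δ markVar ≡ just m → Holds δ d atMark ⇔ d ≡ m
  atMark⇔ δ d = holds-≐ {δ} {d} {⋆} {dvar markVar} refl

  -- Without a mark ahead the greatest fixed point holds trivially, hence the hypothesis `MarkAt`.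
  -- The meaning of `φ` is given under every `ρ` because the fixed point rebinds variable 0.
  await⇔ : ∀ {ρ δ φ m n t} (P : Trc → Set) → lookup δ markVar ≡ just m →
    (∀ ρ t → ⟦ φ ⟧ ρ δ t ⇔ P t) → MarkAt m n t →
    ⟦ await φ ⟧ ρ δ t ⇔ P (shift (suc n) t)
  await⇔ {ρ} {δ} {φ} {m} {n} {t} P eq φ⇔ at = mk⇔ (sound n t at)
    λ p → max-intro 0 body ρ F post (refl , n , at , p)
    where
    body : Formula
    body = [ ¬ᵇ atMark ] fvar 0 ∧ [ atMark ] φ
    F : Interp
    F δ′ t′ = δ′ ≡ δ × ∃[ n ] (MarkAt m n t′ × P (shift (suc n) t′))
    post : ∀ δ′ t′ → F δ′ t′ → ⟦ body ⟧ (ρ [ 0 ↦ F ]) δ′ t′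
    post _ t′ (refl , zero , at , p) =
      (λ h → contradiction (from (atMark⇔ δ (t′ 0) eq) at) h) , λ _ → from (φ⇔ _ _) p
    post _ t′ (refl , suc n , (≢m , at) , p) =
      (λ _ → refl , n , at , p) ,
      λ h → contradiction (to (atMark⇔ δ (t′ 0) eq) h) ≢m
    sound : ∀ n t → MarkAt m n t → ⟦ await φ ⟧ ρ δ t → P (shift (suc n) t)
    sound zero    t at h =
      to (φ⇔ _ _) (proj₂ (max-unfold 0 body ρ {δ} {t} h) (from (atMark⇔ δ (t 0) eq) at))
    sound (suc n) t (≢m , at) h = sound n (t ∘ suc) at
      (proj₁ (max-unfold 0 body ρ {δ} {t} h) (λ k → ≢m (to (atMark⇔ δ (t 0) eq) k)))

  -- Building traces

  datum : ℕ → 𝔻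
  datum = Inverse.from 𝔻↔ℕ

  datum-injective : Injective _≡_ _≡_ datum
  datum-injective {x} {y} eq = trans (sym (Inverse.strictlyInverseˡ 𝔻↔ℕ x))
    (trans (cong (Inverse.to 𝔻↔ℕ) eq) (Inverse.strictlyInverseˡ 𝔻↔ℕ y))

  prepend : List 𝔻 → Trc → Trc
  prepend []       t n       = t n
  prepend (d ∷ ds) t zero    = d
  prepend (d ∷ ds) t (suc n) = prepend ds t n

  IsDatum : DVar → 𝔻 → Set
  IsDatum x d = d ≡ datum x

  reads-prepend : ∀ xs t → Reads IsDatum xs (prepend (map datum xs) t)
  reads-prepend []       t = tt
  reads-prepend (x ∷ xs) t = refl , reads-prepend xs t

  shift-prepend : ∀ xs t → shift (length xs) (prepend (map datum xs) t) ≡ t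
  shift-prepend []       t = refl
  shift-prepend (x ∷ xs) t = shift-prepend xs t

  weave : (ℕ → Block) → Trc
  weave B 0 = B 0 head
  weave B 1 = B 0 state
  weave B 2 = B 0 (ptr left)
  weave B 3 = B 0 (top left)
  weave B 4 = B 0 (rest left)
  weave B 5 = B 0 (ptr right)
  weave B 6 = B 0 (top right)
  weave B 7 = B 0 (rest right)
  -- The ninth position holds no field; its value is arbitrary.
  weave B 8 = B 0 head
  weave B (suc (suc (suc (suc (suc (suc (suc (suc (suc n))))))))) = weave (B ∘ suc) n

  blockAt-weave : ∀ B i f → blockAt (weave B) i f ≡ B i f
  blockAt-weave B (suc i) f            = blockAt-weave (B ∘ suc) i f
  blockAt-weave B zero    head         = refl
  blockAt-weave B zero    state        = refl
  blockAt-weave B zero    (ptr left)   = refl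
  blockAt-weave B zero    (top left)   = refl
  blockAt-weave B zero    (rest left)  = refl
  blockAt-weave B zero    (ptr right)  = refl
  blockAt-weave B zero    (top right)  = refl
  blockAt-weave B zero    (rest right) = refl

  -- Eventually constant traces

  cut : ℕ → Trc → 𝔻 → Trc
  cut zero    t d n       = d
  cut (suc m) t d zero    = t 0
  cut (suc m) t d (suc n) = cut m (t ∘ suc) d n

  prefix-cut : ∀ n t d → prefix (cut n t d) n ≡ prefix t n
  prefix-cut zero    t d = refl
  prefix-cut (suc n) t d = cong (t 0 ∷_) (prefix-cut n (t ∘ suc) d)

  Eventually : 𝔻 → ℕ → Trc → Set
  Eventually d n t = ∀ m → n ≤ m → t m ≡ d

  eventually-cut : ∀ n t d → Eventually d n (cut n t d)
  eventually-cut zero    t d m       _         = refl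
  eventually-cut (suc n) t d (suc m) (s≤s n≤m) = eventually-cut n (t ∘ suc) d m n≤m

  eventually-suc : ∀ {d n t} → Eventually d (suc n) t → Eventually d n (t ∘ suc)
  eventually-suc ev m n≤m = ev (suc m) (s≤s n≤m)

  eventually-weaken : ∀ {d n t} → Eventually d n t → Eventually d (suc n) t
  eventually-weaken ev (suc m) (s≤s n≤m) = ev (suc m) (m≤n⇒m≤1+n n≤m)

  eventually-shift : ∀ k {d n t} → Eventually d n t → Eventually d n (shift k t)
  eventually-shift zero    ev = ev
  eventually-shift (suc k) ev = eventually-shift k (eventually-suc (eventually-weaken ev))

  -- Block `n` starts at position `9 * n`, which is at least `n`.
  eventually-block : ∀ n {d t} f → Eventually d n t → blockAt t n f ≡ d
  eventually-block zero    f ev = ev (fieldIndex f) z≤n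
  eventually-block (suc n) {t = t} f ev =
    eventually-block n f (eventually-shift 8 {t = t ∘ suc} (eventually-suc ev))

-- Traces as computations

module Diagonal (em : ExcludedMiddle (Level.suc 0ℓ)) (𝔻 : Set) (𝔻↔ℕ : 𝔻 ↔ ℕ)
                (M : TM Token) where
  open Logic em 𝔻 𝔻↔ℕ hiding (_⊆_; MonitorableSat; EffectivelyMonitorableSat)
  open Semantics em 𝔻 𝔻↔ℕ
  open Machine M
  open Equivalence using (to; from)

  -- Meaning of the clauses

  Valuation : Set
  Valuation = Const → 𝔻

  Consts : Valuation → DEnv → Set
  Consts C δ = ∀ {c} → c ∈ allConsts → lookup δ (constVar c) ≡ just (C c)

  eval : Valuation → Block → Block → Var → 𝔻
  eval C B B′ (old f)   = B f
  eval C B B′ (new f)   = B′ f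
  eval C B B′ (const c) = C c

  module _ (e : Var → 𝔻) where

    SatEqs : Eqs → Set
    SatEqs = All (λ (x , y) → e x ≡ e y)

    SatClause : Clause → Set
    SatClause (g ⇒ e)   = SatEqs g → SatEqs e
    SatClause (never g) = ¬ SatEqs g

    Sat : List Clause → Set
    Sat = All SatClause

    module _ {δ : DEnv} {d : 𝔻}
             (agree : ∀ v → InScope v → lookup δ (varIndex v) ≡ just (e v)) where

      holds-eqs : ∀ {es} → EqsInScope es → Holds δ d (eqs es) ⇔ SatEqs es
      holds-eqs []             = mk⇔ (λ _ → []) (λ _ → tt)
      holds-eqs {(x , y) ∷ _} ((p , p′) ∷ ps) = mk⇔
        (λ (h , hs) → to heq h ∷ to (holds-eqs ps) hs)
        (λ { (h ∷ hs) → from heq h , from (holds-eqs ps) hs })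
        where
        heq : Holds δ d (dvar (varIndex x) ≐ dvar (varIndex y)) ⇔ e x ≡ e y
        heq = holds-≐ {δ} {d} {dvar _} {dvar _} (agree x p) (agree y p′)

      holds-clause : ∀ {c} → ClauseInScope c → Holds δ d (clause c) ⇔ SatClause c
      holds-clause {g ⇒ e} (p , p′) = mk⇔
        (λ h s → to (holds-eqs p′) (¬¬-elim λ n → h (from (holds-eqs p) s , n)))
        (λ h (s , n) → n (from (holds-eqs p′) (h (to (holds-eqs p) s))))
      holds-clause {never g} p = mk⇔
        (λ h s → h (from (holds-eqs p) s))
        (λ h s → h (to (holds-eqs p) s))

      holds-clauses : ∀ {cs} → All ClauseInScope cs → Holds δ d (clauses cs) ⇔ Sat cs
      holds-clauses []       = mk⇔ (λ _ → []) (λ _ → tt)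
      holds-clauses (p ∷ ps) = mk⇔
        (λ (h , hs) → to (holds-clause p) h ∷ to (holds-clauses ps) hs)
        (λ { (h ∷ hs) → from (holds-clause p) h , from (holds-clauses ps) hs })

  agree-extend : ∀ {C B δ} t → Old B δ → Consts C δ → ∀ v → InScope v →
    lookup (extend newVars t δ) (varIndex v) ≡ just (eval C B (blockAt t 0) v)
  agree-extend t o c (old f)   _ = old-keep t o f
  agree-extend t o c (new f)   _ = new-extend t _ f
  agree-extend t o c (const _) m = c m

  checkNext⇔ : ∀ {ρ C B δ cs} t φ → Old B δ → Consts C δ → All ClauseInScope cs →
    ⟦ checkNext cs φ ⟧ ρ δ t ⇔
    (Sat (eval C B (blockAt t 0)) cs × ⟦ φ ⟧ ρ (extend newVars t δ) (shift 9 t))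
  checkNext⇔ {C = C} {B} {δ} {cs} t φ o c sc =
    ⇔.trans (binds⇔ newVars (check (clauses cs) φ) δ t)
    (⇔.trans (check⇔ (clauses cs) φ (extend newVars t δ) (shift 8 t))
      (mk⇔ (λ (h , p) → to hc h , p) (λ (h , p) → from hc h , p)))
    where
    hc : Holds (extend newVars t δ) (shift 8 t 0) (clauses cs) ⇔ Sat (eval C B (blockAt t 0)) cs
    hc = holds-clauses (eval C B (blockAt t 0)) (agree-extend t o c) sc

  readOld⇔ : ∀ {ρ} δ t φ →
    ⟦ readOld φ ⟧ ρ δ t ⇔ ⟦ φ ⟧ ρ (extend oldVars t δ) (shift 9 t)
  readOld⇔ δ t φ =
    ⇔.trans (binds⇔ oldVars (skip 1 φ) δ t) (skip⇔ 1 φ (extend oldVars t δ) (shift 8 t))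

  bindsUnmarked⇔ : ∀ {ρ m} cs φ δ t → lookup δ markVar ≡ just m →
    ⟦ bindsUnmarked (map constVar cs) (check atMark φ) ⟧ ρ δ t ⇔
    (MarkAt m (length cs) t ×
     ⟦ φ ⟧ ρ (extend (map constVar cs) t δ) (shift (suc (length cs)) t))
  bindsUnmarked⇔ [] φ δ t eq = ⇔.trans (check⇔ atMark φ δ t)
    (mk⇔ (λ (h , p) → to (atMark⇔ δ (t 0) eq) h , p)
         (λ (h , p) → from (atMark⇔ δ (t 0) eq) h , p))
  bindsUnmarked⇔ {ρ} {m} (c ∷ cs) φ δ t eq = mk⇔
    (λ (h , p) → let (at , r) = to rec p in ((λ e → h (from (atMark⇔ δ (t 0) eq) e)) , at) , r)
    (λ ((h , at) , r) → (λ e → h (to (atMark⇔ δ (t 0) eq) e)) , from rec (at , r))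
    where
    ψ = bindsUnmarked (map constVar cs) (check atMark φ)
    rec : ⟦ bind (constVar c) ψ ⟧ ρ δ t ⇔
          (MarkAt m (length cs) (t ∘ suc) ×
           ⟦ φ ⟧ ρ (extend (map constVar (c ∷ cs)) t δ) (shift (suc (length cs)) (t ∘ suc)))
    rec = ⇔.trans (bind⇔ (constVar c) ψ δ t)
                  (bindsUnmarked⇔ cs φ ((constVar c , t 0) ∷ δ) (t ∘ suc) eq)

  -- Meaning of the formula as conditions on blocks

  Spelled : Valuation → List Token → (ℕ → Block) → Set
  Spelled C []      B = B 0 head ≡ C (symᶜ blank)
  Spelled C (a ∷ u) B = B 0 head ≡ C (symᶜ (input a)) × Spelled C u (B ∘ suc)

  Base : Valuation → DEnv → Set
  Base C δ = ∀ {c} → c ∈ baseConsts → lookup δ (constVar c) ≡ just (C c)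

  literal⇔ : ∀ {ρ C δ} u t → Base C δ →
    ⟦ literal u ⟧ ρ δ t ⇔ Spelled C u (blockAt t)
  literal⇔ {ρ} {C} {δ} [] t b = ⇔.trans (check⇔ {ρ} (atSym blank) verum δ t)
    (mk⇔ (λ (h , _) → to heq h) (λ h → from heq h , verum-true {ρ} {δ} {t ∘ suc}))
    where
    heq : Holds δ (t 0) (atSym blank) ⇔ t 0 ≡ C (symᶜ blank)
    heq = holds-≐ {δ} {t 0} {⋆} {dvar _} refl (b (here refl))
  literal⇔ {ρ} {C} {δ} (a ∷ u) t b =
    ⇔.trans (check⇔ (atSym (input a)) (skip 8 (literal u)) δ t)
    (mk⇔ (λ (h , p) → to heq h , to rec p) (λ (h , p) → from heq h , from rec p))
    where
    heq : Holds δ (t 0) (atSym (input a)) ⇔ t 0 ≡ C (symᶜ (input a))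
    heq = holds-≐ {δ} {t 0} {⋆} {dvar _} refl (b (there (∈-map⁺ (symᶜ ∘ input) (∈-tokens a))))
    rec : ⟦ skip 8 (literal u) ⟧ ρ δ (t ∘ suc) ⇔ Spelled C u (blockAt (shift 9 t))
    rec = ⇔.trans (skip⇔ 8 (literal u) δ (t ∘ suc)) (literal⇔ u (shift 9 t) b)

  Starts Lawful : Valuation → (ℕ → Block) → Set
  Starts C B = Sat (eval C (B 0) (B 1)) initially
  Lawful C B = ∀ i → Sat (eval C (B i) (B (suc i))) rules ×
                     (∀ j → Sat (eval C (B i) (B (suc (i + j)))) consistency)

  starts⇔ : ∀ {ρ C δ} t → Consts C δ → ⟦ starts ⟧ ρ δ t ⇔ Starts C (blockAt t)
  starts⇔ {ρ} {C} {δ} t c = ⇔.trans (readOld⇔ {ρ} δ t (checkNext initially verum))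
    (⇔.trans (checkNext⇔ {ρ} {C} {δ = δ′} (shift 9 t) verum (old-extend t δ) c
                initially-scope)
      (mk⇔ proj₁
        (λ p → p , verum-true {ρ} {extend newVars (shift 9 t) δ′} {shift 18 t})))
    where δ′ = extend oldVars t δ

  later : Formula
  later = maxᶠ 1 (checkNext consistency (fvar 1))

  alwaysBody : Formula
  alwaysBody = readOld (fvar 0 ∧ checkNext rules verum ∧ later)

  -- `B` is the block held in the `old` variables; each unfolding moves `t` on by one block and
  -- leaves `B` fixed.
  later-sound : ∀ {ρ C B δ} j t → Old B δ → Consts C δ → ⟦ later ⟧ ρ δ t →
    Sat (eval C B (blockAt t j)) consistency
  later-sound {ρ} {C} {B} {δ} j t o c h = go j
    where
    unfolded = to (checkNext⇔ {ρ [ 1 ↦ ⟦ later ⟧ ρ ]} {C} {B} {δ} t (fvar 1) o c consistency-scope)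
                  (max-unfold 1 (checkNext consistency (fvar 1)) ρ {δ} {t} h)
    go : ∀ j → Sat (eval C B (blockAt t j)) consistency
    go zero    = proj₁ unfolded
    go (suc j) = later-sound {ρ} {C} {B} {extend newVars t δ} j (shift 9 t)
      (old-keep t o) c (proj₂ unfolded)

  later-complete : ∀ {ρ C B δ t} → Old B δ → Consts C δ →
    (∀ j → Sat (eval C B (blockAt t j)) consistency) → ⟦ later ⟧ ρ δ t
  later-complete {ρ} {C} {B} {δ} {t} o c s =
    max-intro 1 (checkNext consistency (fvar 1)) ρ F post {δ} {t} (o , c , s)
    where
    F : Interp
    F δ t = Old B δ × Consts C δ × (∀ j → Sat (eval C B (blockAt t j)) consistency)
    post : ∀ δ t → F δ t → ⟦ checkNext consistency (fvar 1) ⟧ (ρ [ 1 ↦ F ]) δ t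
    post δ t (o , c , s) = from
      (checkNext⇔ {ρ [ 1 ↦ F ]} {C} {B} {δ} t (fvar 1) o c consistency-scope)
      (s 0 , old-keep t o , c , s ∘ suc)

  always-sound : ∀ {ρ C δ} t → Consts C δ → ⟦ always ⟧ ρ δ t → Lawful C (blockAt t)
  always-sound {ρ} {C} {δ} t c h = go
    where
    ρ′ = ρ [ 0 ↦ ⟦ always ⟧ ρ ]
    δ′ = extend oldVars t δ
    unfolded : ⟦ fvar 0 ∧ checkNext rules verum ∧ later ⟧ ρ′ δ′ (shift 9 t)
    unfolded = to (readOld⇔ {ρ′} δ t (fvar 0 ∧ checkNext rules verum ∧ later))
                  (max-unfold 0 alwaysBody ρ {δ} {t} h)
    go : Lawful C (blockAt t)
    go zero    =
      proj₁ (to (checkNext⇔ {ρ′} {C} {δ = δ′} (shift 9 t) verum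
                  (old-extend t δ) c rules-scope) (proj₁ (proj₂ unfolded))) ,
      λ j → later-sound {ρ′} {C} {δ = δ′} j (shift 9 t) (old-extend t δ) c
              (proj₂ (proj₂ unfolded))
    go (suc i) = always-sound {ρ} {C} {δ′} (shift 9 t) c (proj₁ unfolded) i

  always-complete : ∀ {ρ C δ} t → Consts C δ → Lawful C (blockAt t) → ⟦ always ⟧ ρ δ t
  always-complete {ρ} {C} {δ} t c s = max-intro 0 alwaysBody ρ F post {δ} {t} (c , s)
    where
    F : Interp
    F δ t = Consts C δ × Lawful C (blockAt t)
    ρ′ = ρ [ 0 ↦ F ]
    post : ∀ δ t → F δ t → ⟦ alwaysBody ⟧ ρ′ δ t
    post δ t (c , s) =
      from (readOld⇔ {ρ′} δ t (fvar 0 ∧ checkNext rules verum ∧ later))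
      ( (c , s ∘ suc)
      , from (checkNext⇔ {ρ′} {C} {δ = extend oldVars t δ} (shift 9 t) verum
               (old-extend t δ) c rules-scope)
          (proj₁ (s 0) , λ f → f tt)
      , later-complete {ρ′} {C} {δ = extend oldVars t δ} {t = shift 9 t}
          (old-extend t δ) c (proj₂ (s 0)))

  bodyOf : List DVar → Trc → Trc
  bodyOf xs t = shift (suc (length extraConsts)) (shift (length xs) t)

  record Models (C : Valuation) (u : List Token) (B : ℕ → Block) : Set where
    field
      spelled : Spelled C u B
      begins  : Starts C B
      lawful  : Lawful C B

  envOf : List DVar → Trc → DEnv
  envOf xs t = extend extraVars (shift (length xs) t) (extend xs t [])

  run-on⇔ : ∀ {ρ C m} xs t u → lookup (extend xs t []) markVar ≡ just m →
    Base C (extend xs t []) → Consts C (envOf xs t) →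
    ⟦ run-on xs u ⟧ ρ [] t ⇔
    (MarkAt m (length extraConsts) (shift (length xs) t) ×
     Models C u (blockAt (bodyOf xs t)))
  run-on⇔ {ρ} {C} {m} xs t u eq b c =
    ⇔.trans (binds⇔ xs (await (literal u) ∧ simulation) [] t) (mk⇔ fwd bwd)
    where
    δ = extend xs t []
    t′ = shift (length xs) t
    Meaning = MarkAt m (length extraConsts) t′ × Models C u (blockAt (bodyOf xs t))
    sim⇔ = bindsUnmarked⇔ {ρ} {m} extraConsts (starts ∧ always) δ t′ eq
    lit⇔ : MarkAt m (length extraConsts) t′ →
      ⟦ await (literal u) ⟧ ρ δ t′ ⇔ Spelled C u (blockAt (bodyOf xs t))
    lit⇔ = await⇔ {ρ} {δ} {literal u} {m} {length extraConsts} {t′}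
      (λ t → Spelled C u (blockAt t)) eq (λ ρ t → literal⇔ {ρ} {C} u t b)
    fwd : ⟦ await (literal u) ∧ simulation ⟧ ρ δ t′ → Meaning
    fwd (l , s) = let (at , st , al) = to sim⇔ s in at , record
      { spelled = to (lit⇔ at) l
      ; begins  = to (starts⇔ {ρ} {C} {envOf xs t} (bodyOf xs t) c) st
      ; lawful  = always-sound {ρ} {C} {envOf xs t} (bodyOf xs t) c al }
    bwd : Meaning → ⟦ await (literal u) ∧ simulation ⟧ ρ δ t′
    bwd (at , mo) = from (lit⇔ at) (Models.spelled mo) , from sim⇔
      (at , from (starts⇔ {ρ} {C} {envOf xs t} (bodyOf xs t) c) (Models.begins mo)
          , always-complete {ρ} {C} {envOf xs t} (bodyOf xs t) c (Models.lawful mo))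

  module _ (xs : List DVar) (base⊆ : baseVars ⊆ xs) where

    models-of : ∀ {ρ t} u → ⟦ run-on xs u ⟧ ρ [] t →
      ∃[ C ] Models C u (blockAt (bodyOf xs t))
    models-of {ρ} {t} u h =
      C , proj₂ (to (run-on⇔ {ρ} {C} xs t u (proj₁ (proj₂ mark)) base consts) h)
      where
      t′ = shift (length xs) t
      C : Valuation
      -- The constants are whatever the trace supplies. The default `t 0` can matter only outside
      -- `allConsts`.
      C c = fromMaybe (t 0) (lookup (envOf xs t) (constVar c))
      in-xs : ∀ {x} → x ∈ xs → ∃[ d ] lookup (extend xs t []) x ≡ just d × ⊤
      in-xs m = extend-reads xs (reads-any xs t) (inj₁ m)
      mark = in-xs (base⊆ (here refl))
      bound : ∀ {c} → c ∈ allConsts →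
        ∃[ d ] lookup (envOf xs t) (constVar c) ≡ just d × ⊤
      bound m = extend-reads extraVars (reads-any extraVars t′)
        ([ (λ b → inj₂ (in-xs (base⊆ (there (∈-map⁺ constVar b)))))
         , (λ e → inj₁ (∈-map⁺ constVar e)) ]′ (∈-++⁻ baseConsts m))
      consts : Consts C (envOf xs t)
      consts m = let (d , eq , _) = bound m in
        trans eq (cong just (sym (cong (fromMaybe (t 0)) eq)))
      base : Base C (extend xs t [])
      base m = trans (sym (extend-other extraVars (base∉extra m))) (consts (∈-++⁺ˡ m))

  -- Soundness: every model follows the run

  module Sound {C : Valuation} {B : ℕ → Block} {u : List Token} (models : Models C u B) where
    open Models models

    startEqs : SatEqs (eval C (B 0) (B 1))
      ((old state , ctlConst load) ∷ emptyEqs left ++ emptyEqs right)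
    startEqs = All.head begins []

    initial-state : B 0 state ≡ C (ctlᶜ load)
    initial-state = All.head startEqs

    initial-empty : ∀ s → SatEqs (eval C (B 0) (B 1)) (emptyEqs s)
    initial-empty left  = proj₁ (All.++⁻ (emptyEqs left) (All.tail startEqs))
    initial-empty right = proj₂ (All.++⁻ (emptyEqs left) (All.tail startEqs))

    sat-rule : ∀ i {c} → c ∈ rules → SatClause (eval C (B i) (B (suc i))) c
    sat-rule i = All.lookup (proj₁ (lawful i))

    SameCell : Move → Block → Block → Set
    SameCell s b b′ = b (ptr s) ≡ b′ (ptr s) →
      b (top s) ≡ b′ (top s) × b (rest s) ≡ b′ (rest s)

    same-later : ∀ s i j → SameCell s (B i) (B (suc (i + j)))
    same-later s i j eq with proj₂ (lawful i) j
    same-later left  i j eq | p ∷ _ with p (eq ∷ [])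
    ... | e₁ ∷ e₂ ∷ [] = e₁ , e₂
    same-later right i j eq | _ ∷ p ∷ [] with p (eq ∷ [])
    ... | e₁ ∷ e₂ ∷ [] = e₁ , e₂

    same : ∀ s i j → SameCell s (B i) (B j)
    same s i j eq with compare i j
    ... | less i d    = same-later s i d eq
    ... | equal i     = refl , refl
    ... | greater j d = let (e₁ , e₂) = same-later s j d (sym eq) in sym e₁ , sym e₂

    -- The cells of a represented list may occur in any block, earlier or later:
    -- agreement of equal names is all that popping needs.
    data Rep (s : Move) : 𝔻 → List Sym → Set where
      nil  : Rep s (B 0 (ptr s)) []
      cons : ∀ i {a l} → B i (top s) ≡ C (symᶜ a) → Rep s (B i (rest s)) l →
             Rep s (B i (ptr s)) (a ∷ l)

    -- The cell `x` is described in some block, and equality of contents under equal names carries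
    -- the description to block `i`. For the empty list it is the self-pointing blank of block 0.
    rep-pop : ∀ {s x l} → Rep s x l → ∀ i → B i (ptr s) ≡ x →
      B i (top s) ≡ C (symᶜ (topOf l)) × Rep s (B i (rest s)) (drop 1 l)
    rep-pop {s} nil i eq with same s i 0 eq | initial-empty s
    ... | e₁ , e₂ | e₃ ∷ e₄ ∷ [] =
      trans e₁ e₃ , subst (λ x → Rep s x []) (sym (trans e₂ e₄)) nil
    rep-pop {s} (cons j {l = l} e r) i eq with same s i j eq
    ... | e₁ , e₂ = trans e₁ e , subst (λ x → Rep s x l) (sym e₂) r

    data Match (i : ℕ) : Conf → Set where
      match : ∀ {p a l r} → B i state ≡ C (ctlᶜ p) → B i head ≡ C (symᶜ a) →
        Rep left (B i (ptr left)) l → Rep right (B i (ptr right)) r →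
        Match i (conf p a l r)

    perform-rep : ∀ i s o {l} → SatEqs (eval C (B i) (B (suc i))) (stackEqs s o) →
      Rep s (B i (ptr s)) l → Rep s (B (suc i) (ptr s)) (perform o l)
    perform-rep i s keep {l} (e ∷ []) r = subst (λ x → Rep s x l) (sym e) r
    perform-rep i s pop {l}  (e ∷ []) r =
      subst (λ x → Rep s x (drop 1 l)) (sym e) (proj₂ (rep-pop r i refl))
    perform-rep i s (push a) {l} (e ∷ e′ ∷ []) r =
      cons (suc i) e (subst (λ x → Rep s x l) (sym e′) r)

    head-match : ∀ i h {a l r} → SatEqs (eval C (B i) (B (suc i))) (headEqs h) →
      B i head ≡ C (symᶜ a) → Rep left (B i (ptr left)) l →
      Rep right (B i (ptr right)) r → B (suc i) head ≡ C (symᶜ (nextHead h a l r))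
    head-match i keep         (e ∷ []) h _ _ = trans e h
    head-match i (take left)  (e ∷ []) _ l _ = trans e (proj₁ (rep-pop l i refl))
    head-match i (take right) (e ∷ []) _ _ r = trans e (proj₁ (rep-pop r i refl))

    next-match : ∀ i {c} → Ready c → Match i c → Match (suc i) (next c)
    next-match i {conf p a l r} ready (match hp ha hl hr)
      with sat-rule i (ready-rule {l = l} {r} ready) (hp ∷ ha ∷ [])
    ... | e ∷ es with All.++⁻ (headEqs (headOp (transition p a))) es
    ... | eh , es′ with All.++⁻ (stackEqs left (opOn (transition p a) left)) es′
    ... | el , er = match e (head-match i (headOp (transition p a)) eh ha hl hr)
      (perform-rep i left (opOn (transition p a) left) el hl)
      (perform-rep i right (opOn (transition p a) right) er hr)

    iterate-match : ∀ n i {c} → Ready c → Match i c → ∃[ j ] Match j (iterate next c n)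
    iterate-match zero    i     ready m = i , m
    iterate-match (suc n) i {c} ready m =
      iterate-match n (suc i) (ready-next {c} ready) (next-match i ready m)

    -- `B′` is `B` from block `i` on; it is kept separate because `Spelled` recurses on the shifted
    -- sequence.
    load-match : ∀ v {l} i B′ → (∀ j → B′ j ≡ B (j + i)) → Spelled C v B′ →
      B i state ≡ C (ctlᶜ load) → (∀ s → Rep s (B i (ptr s)) l) →
      ∃[ j ] Match j (loaded v l)
    load-match []      i B′ eq h        st rep =
      i , match st (trans (cong (λ b → b head) (sym (eq 0))) h) (rep left) (rep right)
    load-match (a ∷ v) {l} i B′ eq (h , hs) st rep
      with sat-rule i (loadRule∈ a)
             (st ∷ trans (cong (λ b → b head) (sym (eq 0))) h ∷ [])
    ... | e ∷ e₁ ∷ e₂ ∷ e₃ ∷ e₄ ∷ [] =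
      load-match v (suc i) (B′ ∘ suc)
        (λ j → trans (eq (suc j)) (cong B (sym (+-suc j i)))) hs e
        λ { left  → perform-rep i left (push (input a)) (e₁ ∷ e₂ ∷ []) (rep left)
          ; right → perform-rep i right (push (input a)) (e₃ ∷ e₄ ∷ []) (rep right) }

    matches : ∀ n → ∃[ j ] Match j (iterate next (loaded u []) n)
    matches n =
      let (j , m) = load-match u 0 B (λ j → cong B (sym (+-identityʳ j))) spelled
                      initial-state (λ s → nil)
      in iterate-match n j (inj₂ (refl , refl)) m

    never-reject : ∀ n → ctlOf (iterate next (loaded u []) n) ≢ tm reject
    never-reject n eq with iterate next (loaded u []) n | matches n
    never-reject n refl | conf _ _ _ _ | j , match hp _ _ _ =
      -- The first clause of `rules` forbids the rejecting state.
      sat-rule j (here refl) (hp ∷ [])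

    state≢head : ∀ i → B i state ≢ B i head
    state≢head i eq = sat-rule i (there (here refl)) (eq ∷ [])

  -- Constants are interpreted by the datum numbered like their variable, so
  -- that they are distinct.
  canonical : Valuation
  canonical c = datum (constVar c)

  marked : List Const → Trc → Trc
  marked cs t = prepend (map datum (map constVar cs)) (prepend (datum markVar ∷ []) t)

  markAt-marked : ∀ cs t → MarkAt (datum markVar) (length cs) (marked cs t)
  markAt-marked []       t = refl
  markAt-marked (c ∷ cs) t = (λ eq → constVar≢mark (datum-injective eq)) , markAt-marked cs t
    where
    constVar≢mark : constVar c ≢ markVar
    constVar≢mark ()

  shift-marked : ∀ cs t → shift (suc (length cs)) (marked cs t) ≡ t
  shift-marked []       t = refl
  shift-marked (c ∷ cs) t = shift-marked cs t

  module _ (xs : List DVar) (base⊆ : baseVars ⊆ xs) where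

    traceOf : Trc → Trc
    traceOf t = prepend (map datum xs) (marked extraConsts t)

    satisfies : ∀ {ρ t} u → Models canonical u (blockAt t) →
      ⟦ run-on xs u ⟧ ρ [] (traceOf t)
    satisfies {ρ} {t} u models = from
      (run-on⇔ {ρ} {canonical} xs (traceOf t) u (in-xs (base⊆ (here refl)))
        (λ m → in-xs (base⊆ (there (∈-map⁺ constVar m)))) consts)
      ( subst (MarkAt (datum markVar) (length extraConsts))
              (sym (shift-prepend xs (marked extraConsts t))) (markAt-marked extraConsts t)
      , subst (λ t′ → Models canonical u (blockAt t′)) (sym body) models)
      where
      t₀ = shift (length xs) (traceOf t)
      body : bodyOf xs (traceOf t) ≡ t
      body = trans (cong (shift (suc (length extraConsts)))
                         (shift-prepend xs (marked extraConsts t)))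
                   (shift-marked extraConsts t)
      canon : ∀ {δ x} → ∃[ d ] lookup δ x ≡ just d × IsDatum x d → lookup δ x ≡ just (datum x)
      canon (d , eq , refl) = eq
      in-xs : ∀ {x} → x ∈ xs → lookup (extend xs (traceOf t) []) x ≡ just (datum x)
      in-xs m = canon {extend xs (traceOf t) []}
        (extend-reads xs (reads-prepend xs (marked extraConsts t)) (inj₁ m))
      reads-extra : Reads IsDatum extraVars t₀
      reads-extra = subst (Reads IsDatum extraVars)
        (sym (shift-prepend xs (marked extraConsts t))) (reads-prepend extraVars _)
      consts : Consts canonical (envOf xs (traceOf t))
      consts m = canon {envOf xs (traceOf t)} (extend-reads extraVars reads-extra
        ([ (λ b → inj₂ (_ , in-xs (base⊆ (there (∈-map⁺ constVar b))) , refl))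
         , (λ e → inj₁ (∈-map⁺ constVar e)) ]′ (∈-++⁻ baseConsts m)))

  -- Completeness: a run that never rejects gives a model

  stackCode : List Sym → ℕ
  stackCode = listCode ∘ map (constVar ∘ symᶜ)

  stackCode-injective : Injective _≡_ _≡_ stackCode
  stackCode-injective eq =
    map-injective (symᶜ-injective ∘ constVar-injective) (listCode-injective eq)

  headOf : Conf → Sym
  headOf (conf _ a _ _) = a

  -- Naming a cell by a code of the whole list it heads makes equal names have
  -- equal contents.
  fieldCode : Conf → Field → ℕ
  fieldCode c head     = constVar (symᶜ (headOf c))
  fieldCode c state    = constVar (ctlᶜ (ctlOf c))
  fieldCode c (ptr s)  = stackCode (stackOf c s)
  fieldCode c (top s)  = constVar (symᶜ (topOf (stackOf c s)))
  fieldCode c (rest s) = stackCode (drop 1 (stackOf c s))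

  Depicts : Block → Conf → Set
  Depicts b c = ∀ f → b f ≡ datum (fieldCode c f)

  depicts-const : ∀ {b c} f d → Depicts b c → b f ≡ canonical d → fieldCode c f ≡ constVar d
  depicts-const f d dep eq = datum-injective (trans (sym (dep f)) eq)

  module _ {b b′ : Block} {c c′ : Conf} (dep : Depicts b c) (dep′ : Depicts b′ c′) where

    e : Var → 𝔻
    e = eval canonical b b′

    new-old : ∀ {f f′} → fieldCode c′ f ≡ fieldCode c f′ → b′ f ≡ b f′
    new-old {f} {f′} eq = trans (dep′ f) (trans (cong datum eq) (sym (dep f′)))

    sat-same : All (SatClause e) consistency
    sat-same = cell left ∷ cell right ∷ []
      where
      cell : ∀ s → SatClause e (sameCell s)
      cell s (eq ∷ []) =
        sym (new-old (cong (constVar ∘ symᶜ ∘ topOf) (sym stacks))) ∷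
        sym (new-old (cong (stackCode ∘ drop 1) (sym stacks))) ∷ []
        where
        stacks : stackOf c s ≡ stackOf c′ s
        stacks = stackCode-injective
          (datum-injective (trans (sym (dep (ptr s))) (trans eq (dep′ (ptr s)))))

    sat-stack : ∀ s o → stackOf c′ s ≡ perform o (stackOf c s) → SatEqs e (stackEqs s o)
    sat-stack s keep     eq = new-old (cong stackCode eq) ∷ []
    sat-stack s pop      eq = new-old (cong stackCode eq) ∷ []
    sat-stack s (push a) eq =
      trans (dep′ (top s)) (cong (canonical ∘ symᶜ ∘ topOf) eq) ∷
      new-old (cong (stackCode ∘ drop 1) eq) ∷ []

  -- Canonical constants have distinct values, so the guard of a rule holds only in the state and
  -- head symbol it names.
  at-inj : ∀ {b b′ p a l r p′ a′} → Depicts b (conf p a l r) →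
    SatEqs (eval canonical b b′) (at p′ a′) → p ≡ p′ × a ≡ a′
  at-inj {p′ = p′} {a′} dep (ep ∷ ea ∷ []) =
    ctlᶜ-injective (constVar-injective (depicts-const state (ctlᶜ p′) dep ep)) ,
    symᶜ-injective (constVar-injective (depicts-const head (symᶜ a′) dep ea))

  sat-effect : ∀ {b b′} α a l r {p} → Depicts b (conf p a l r) →
    Depicts b′ (execute α a l r) → SatEqs (eval canonical b b′) (effect α)
  sat-effect α a l r {p} dep dep′ = dep′ state ∷ All.++⁺ (heads (headOp α) refl)
    (All.++⁺ (sat-stack dep dep′ left (opOn α left) refl)
             (sat-stack dep dep′ right (opOn α right) refl))
    where
    heads : ∀ h → headOf (execute α a l r) ≡ nextHead h a l r →
      SatEqs (eval canonical _ _) (headEqs h)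
    heads keep         eq = new-old dep dep′ {head} {head} (cong (constVar ∘ symᶜ) eq) ∷ []
    heads (take left)  eq = new-old dep dep′ {head} {top left} (cong (constVar ∘ symᶜ) eq) ∷ []
    heads (take right) eq = new-old dep dep′ {head} {top right} (cong (constVar ∘ symᶜ) eq) ∷ []

  sat-rules : ∀ {b b′ c c′} → c ⟶ c′ → ctlOf c ≢ tm reject → Depicts b c → Depicts b′ c′ →
    Sat (eval canonical b b′) rules
  sat-rules {b} {b′} {c} {c′} st ≢reject dep dep′ =
    (λ { (eq ∷ []) → ≢reject (ctlᶜ-injective (constVar-injective
                       (depicts-const state (ctlᶜ (tm reject)) dep eq))) }) ∷
    (λ { (eq ∷ []) → ctl≢sym (constVar-injective (datum-injective
                       (trans (sym (dep state)) (trans eq (dep head))))) }) ∷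
    ruleSat load blank (λ _ _ → refl) st dep dep′ ∷
    All.++⁺ (All.map⁺ {f = loadRule} (All.universal (λ a → loadSat a st dep dep′) tokens))
      (All.cartesianProductWith⁺ (setoid Ctl) (setoid Sym) rule ctls syms
        λ {p} {a} m _ → ruleSat p a (λ { refl → contradiction m load∉ctls }) st dep dep′)
    where
    ctl≢sym : ∀ {p a} → ctlᶜ p ≢ symᶜ a
    ctl≢sym ()
    -- The side condition excludes rules for `load` on a token, which a loading step would violate.
    ruleSat : ∀ p a → (p ≡ load → ∀ {a′} → a ≡ input a′ → a ≡ blank) →
      ∀ {c c′} → c ⟶ c′ → Depicts b c → Depicts b′ c′ →
      SatClause (eval canonical b b′) (rule p a)
    ruleSat p a h {conf _ _ l r} (moving _) dep dep′ g with at-inj {b} {b′} dep g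
    ... | refl , refl = sat-effect (transition p a) a l r dep dep′
    ruleSat p a h loading dep dep′ g with at-inj {b} {b′} dep g
    ... | refl , refl with h refl refl
    ... | ()
    loadSat : ∀ a {c c′} → c ⟶ c′ → Depicts b c → Depicts b′ c′ →
      SatClause (eval canonical b b′) (loadRule a)
    loadSat a (moving h) dep dep′ g with at-inj {b} {b′} dep g
    ... | refl , refl with h refl
    ... | ()
    loadSat a loading dep dep′ g with at-inj {b} {b′} dep g
    ... | refl , refl = dep′ state ∷
      All.++⁺ (sat-stack dep dep′ left (push (input a)) refl)
              (sat-stack dep dep′ right (push (input a)) refl)

  sat-initially : ∀ {b b′ a} → Depicts b (conf load a [] []) →
    Sat (eval canonical b b′) initially
  sat-initially dep =
    (λ _ → dep state ∷ dep (top left) ∷ trans (dep (rest left)) (sym (dep (ptr left))) ∷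
           dep (top right) ∷ trans (dep (rest right)) (sym (dep (ptr right))) ∷ []) ∷ []

  spelled-run : ∀ u {l} {B : ℕ → Block} → (∀ i → Depicts (B i) (runFrom u l i)) →
    Spelled canonical u B
  spelled-run []      dep = dep 0 head
  spelled-run (a ∷ u) dep = dep 0 head , spelled-run u (dep ∘ suc)

  models-run : ∀ u {B : ℕ → Block} → (∀ i → Depicts (B i) (runFrom u [] i)) →
    (∀ i → ctlOf (runFrom u [] i) ≢ tm reject) → Models canonical u B
  models-run u {B} dep ≢reject = record
    { spelled = spelled-run u dep
    ; begins  = begins u (dep 0)
    ; lawful  = λ i →
        sat-rules (runFrom-step u [] i) (≢reject i) (dep i) (dep (suc i)) ,
        λ j → sat-same (dep i) (dep (suc (i + j)))
    }
    where
    begins : ∀ u → Depicts (B 0) (runFrom u [] 0) → Starts canonical B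
    -- The case split only lets `runFrom u [] 0` compute to a loading configuration with empty
    -- stacks.
    begins []      = sat-initially
    begins (a ∷ u) = sat-initially

  runTrace : List Token → Trc
  runTrace u = weave λ i f → datum (fieldCode (runFrom u [] i) f)

  models-runTrace : ∀ u → (∀ i → ctlOf (runFrom u [] i) ≢ tm reject) →
    Models canonical u (blockAt (runTrace u))
  models-runTrace u = models-run u (blockAt-weave _)

  -- Satisfiability of the diagonal formula

  module _ (xs : List DVar) (base⊆ : baseVars ⊆ xs) (u : List Token) where

    reject-unsat : ∀ {ρ t} n → ctlOf (iterate next (loaded u []) n) ≡ tm reject →
      ¬ ⟦ run-on xs u ⟧ ρ [] t
    reject-unsat {ρ} {t} n eq h =
      Sound.never-reject (proj₂ (models-of xs base⊆ {ρ} {t} u h)) n eq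

    -- Both halting states are absorbing, so an accepting run never rejects and its trace is a
    -- model.
    accept-sat : ∀ {ρ} n → ctlOf (iterate next (loaded u []) n) ≡ tm accept →
      ∃[ t ] ⟦ run-on xs u ⟧ ρ [] t
    accept-sat {ρ} n accepted = traceOf xs base⊆ (runTrace u) ,
      satisfies xs base⊆ {ρ} {runTrace u} u (models-runTrace u λ i eq →
        let (m , rejected) = runFrom-reject u [] i eq in
        absorbing-disjoint next (λ c → ctlOf c ≡ tm accept) (λ c → ctlOf c ≡ tm reject)
          (λ {c} → halted-next {c = c} (λ _ → refl)) (λ {c} → halted-next {c = c} (λ _ → refl))
          (λ p r → accept≢reject (trans (sym p) r))
          n m (loaded u []) accepted rejected)
      where
      accept≢reject : tm accept ≢ tm reject
      accept≢reject ()

    -- All fields of block `n` equal `t 0`, so its state equals its head, which `rules` forbids.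
    -- Here `t 0` merely supplies some value.
    cut-unsat : ∀ {ρ} n t → ¬ ⟦ run-on xs u ⟧ ρ [] (cut n t (t 0))
    cut-unsat {ρ} n t h =
      Sound.state≢head (proj₂ (models-of xs base⊆ {ρ} {cut n t (t 0)} u h)) n
        (trans (eventually-block n state ev) (sym (eventually-block n head ev)))
      where
      ev : Eventually (t 0) n (bodyOf xs (cut n t (t 0)))
      ev = eventually-shift (suc (length extraConsts))
             {t = shift (length xs) (cut n t (t 0))}
             (eventually-shift (length xs) {t = cut n t (t 0)} (eventually-cut n t (t 0)))

  record Diagonalises (φ : Formula) : Set where
    field
      in-sHML    : sHML φ
      closed     : Closed φ
      guarded    : Guarded φ
      accept⇒sat : Accepts M (codeFormula φ) → ∃[ t ] t ⊨ φ
      reject⇒unsat : Rejects M (codeFormula φ) → ∀ t → ¬ (t ⊨ φ)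
      cut⇒unsat  : ∀ n t → ¬ (cut n t (t 0) ⊨ φ)

  -- Stated for a general xs: with baseVars unfolded, comparing semantics is
  -- prohibitively slow.
  diagonalises : ∀ xs w → baseVars ⊆ xs →
    codeFormula (run-on xs (reverse w)) ≡ preamble ++ concatMap block (reverse w) ++ w →
    Diagonalises (run-on xs (reverse w))
  diagonalises xs w base⊆ code≡ = record
    { in-sHML = sHML-run-on xs (reverse w)
    ; closed  = closed-run-on (reverse w) base⊆
    ; guarded = guarded-run-on xs (reverse w)
    ; accept⇒sat = λ acc → let (n , eq) = reaches acc in
        accept-sat xs base⊆ (reverse w) n eq
    ; reject⇒unsat = λ rej t → let (n , eq) = reaches rej in
        reject-unsat xs base⊆ (reverse w) {t = t} n eq
    ; cut⇒unsat = cut-unsat xs base⊆ (reverse w)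
    }
    where
    reaches : ∀ {s} → Reaches M s (codeFormula (run-on xs (reverse w))) →
      ∃[ n ] ctlOf (iterate next (loaded (reverse w) []) n) ≡ tm s
    reaches {s} r = tm-run w (subst (Reaches M s) code≡ r)

  diagonal : ∃[ φ ] Diagonalises φ
  diagonal = run-on baseVars (reverse tape) ,
    diagonalises baseVars tape (λ p → p) (code-run-on baseVars (reverse tape))

-- Undecidability

module _ (em : ExcludedMiddle (Level.suc 0ℓ)) (𝔻 : Set) (𝔻↔ℕ : 𝔻 ↔ ℕ) where
  open Logic em 𝔻 𝔻↔ℕ hiding (_⊆_; MonitorableSat; EffectivelyMonitorableSat)
  open Semantics em 𝔻 𝔻↔ℕ using (cut; prefix-cut)

  -- What both notions of monitorability share: satisfaction is witnessed by a finite prefix.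
  Recognisable : Formula → Set₁
  Recognisable φ =
    Σ[ A ∈ (List 𝔻 → Set) ] (∀ t → (∃[ n ] A (prefix t n)) ⇔ (t ⊨ φ))

  -- `P` lies between unsatisfiability and recognisability. On its own diagonal formula a decider
  -- errs either way: acceptance makes the formula satisfiable but not recognisable, rejection makes
  -- it unsatisfiable.
  undecidable : ∀ {ℓ} (F : Formula → Set) (P : Formula → Set ℓ) →
    (∀ φ → sHML φ → F φ) →
    (∀ φ → P φ → Recognisable φ) →
    (∀ φ → (∀ t → ¬ (t ⊨ φ)) → P φ) →
    Undecidable F P
  undecidable F P sHML⊆F recognise unsat⇒P (M , decides) =
    refute (Diagonal.diagonal em 𝔻 𝔻↔ℕ M)
    where
    open _Decides_On_Via_ decides
    open Equivalence using (to; from)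
    open Diagonal em 𝔻 𝔻↔ℕ M using (Diagonalises)

    refute : ¬ (∃[ φ ] Diagonalises φ)
    refute (φ , diagonalises) = [ accepted , rejected ]′ (halts φ instance-φ)
      where
      open Diagonalises diagonalises

      instance-φ : F φ × Closed φ × Guarded φ
      instance-φ = sHML⊆F φ in-sHML , closed , guarded

      accepted : ¬ Accepts M (codeFormula φ)
      accepted acc with recognise φ (to (correct φ instance-φ) acc) | accept⇒sat acc
      ... | A , A⇔ | t , t⊨ with from (A⇔ t) t⊨
      -- The cut trace shares the accepted prefix of length `n`, so it would have to satisfy `φ`
      -- too.
      ... | n , An = cut⇒unsat n t
        (to (A⇔ (cut n t (t 0))) (n , subst A (sym (prefix-cut n t (t 0))) An))

      rejected : ¬ Rejects M (codeFormula φ)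
      rejected rej = accept-reject-disjoint M
        (from (correct φ instance-φ) (unsat⇒P φ (reject⇒unsat rej))) rej

  monitorable⇒recognisable : ∀ φ →
    MonitorableSat em 𝔻 𝔻↔ℕ φ → Recognisable φ
  monitorable⇒recognisable φ (m , m⇔) = Monitor.acc m , m⇔

  effective⇒recognisable : ∀ φ →
    EffectivelyMonitorableSat em 𝔻 𝔻↔ℕ φ → Recognisable φ
  effective⇒recognisable φ (N , N⇔) = Accepts N ∘ codeWord , ⇔.sym ∘ N⇔

  unsat⇒monitorable : ∀ φ → (∀ t → ¬ (t ⊨ φ)) → MonitorableSat em 𝔻 𝔻↔ℕ φ
  unsat⇒monitorable φ unsat =
    record { acc = λ _ → ⊥ ; rej = λ _ → ⊥ ; disjoint = λ _ ()
           ; acc-ext = λ _ _ () ; rej-ext = λ _ _ () } ,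
    λ t → mk⇔ (λ ()) (λ t⊨ → contradiction t⊨ (unsat t))

  rejecting : TM Bool
  rejecting = record { q = 0 ; k = 0 ; start = reject ; δ = λ () }

  rejecting-rejects : ∀ w → Rejects rejecting w
  rejecting-rejects []      = 0 , refl
  rejecting-rejects (_ ∷ _) = 0 , refl

  unsat⇒effective : ∀ φ → (∀ t → ¬ (t ⊨ φ)) → EffectivelyMonitorableSat em 𝔻 𝔻↔ℕ φ
  unsat⇒effective φ unsat = rejecting , λ t → mk⇔
    (λ t⊨ → contradiction t⊨ (unsat t))
    (λ (n , acc) → contradiction (rejecting-rejects _) (accept-reject-disjoint rejecting acc))

corollary28 : (em : ExcludedMiddle (Level.suc 0ℓ)) (𝔻 : Set) (𝔻↔ℕ : 𝔻 ↔ ℕ) →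
    (Undecidable sHML (MonitorableSat em 𝔻 𝔻↔ℕ) ×
    Undecidable sHML (EffectivelyMonitorableSat em 𝔻 𝔻↔ℕ)) ×
    (Undecidable μHML (MonitorableSat em 𝔻 𝔻↔ℕ) ×
    Undecidable μHML (EffectivelyMonitorableSat em 𝔻 𝔻↔ℕ))
corollary28 em 𝔻 𝔻↔ℕ =
  ( undecidable em 𝔻 𝔻↔ℕ sHML _ (λ _ s → s) monitorable unsat-monitorable
  , undecidable em 𝔻 𝔻↔ℕ sHML _ (λ _ s → s) effective unsat-effective ) ,
  ( undecidable em 𝔻 𝔻↔ℕ μHML _ (λ _ _ → tt) monitorable unsat-monitorable
  , undecidable em 𝔻 𝔻↔ℕ μHML _ (λ _ _ → tt) effective unsat-effective )
  where
  monitorable       = monitorable⇒recognisable em 𝔻 𝔻↔ℕ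
  effective         = effective⇒recognisable em 𝔻 𝔻↔ℕ
  unsat-monitorable = unsat⇒monitorable em 𝔻 𝔻↔ℕ
  unsat-effective   = unsat⇒effective em 𝔻 𝔻↔ℕ
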